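{- Let $\vec a=(a_1,\ldots,a_n)$ be a vector of relatively prime positive integers, let $d_i=\gcd(\vec a_{ -i})$ for $1\le i\le n$, and let $p=d_1\cdots d_n$. Then there are constants $C_1,C_2$ (depending on $\vec a$) such that, for all sufficiently large $s\in\mathbb{Z}_{\ge 0}$, writing $k=f(sp)$: \begin{align*} g_{=k}=g_{\le k}&=sp+\sum_{i=1}^n(d_i-1)a_i,\\ h_{=k}=h_{\ge k}&=sp,\\ c_{=k}&=p,\\ c_{\le k}&=sp+C_1,\\ s_{=k}&=sp^2+\sum_{i=1}^n\frac{pa_i(d_i-1)}{2},\\ s_{\le k}&=\frac{1}{2}(sp)^2+\left(\frac{p+\sum_{i=1}^n a_i(d_i-1)}{2}\right)sp+C_2,\\ F_{=k}(x)&=x^{sp}\prod_{i=1}^n\frac{1-x^{d_ia_i}}{1-x^{a_i}},\\ F_{\ge k}(x)&=\frac{x^{sp}}{1-x^p}\prod_{i=1}^n\frac{1-x^{d_ia_i}}{1-x^{a_i}}. \end{align*}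
   Context: For $t\in\mathbb{Z}_{\ge 0}$, $f(t)=f(\vec a;t)=\#\{(x_1,\ldots,x_n)\in\mathbb{Z}_{\ge 0}^n:\ a_1x_1+\cdots+a_nx_n=t\}$. $\vec a_{ -i}$ denotes $\vec a$ with the $i$th entry removed. For $k\in\mathbb{Z}_{\ge0}$: $g_{=k}$ (resp. $g_{\le k}$) is the maximum $t\in\mathbb{Z}_{\ge 0}$ with $f(t)=k$ (resp. $f(t)\le k$); $h_{=k}$ (resp. $h_{\ge k}$) is the minimum $t\in\mathbb{Z}_{\ge 0}$ with $f(t)=k$ (resp. $f(t)\ge k$); $c_{=k}$ (resp. $c_{\le k}$) is the number of $t\in\mathbb{Z}_{\ge 0}$ with $f(t)=k$ (resp. $f(t)\le k$); $s_{=k}$ (resp. $s_{\le k}$) is the sum of all $t\in\mathbb{Z}_{\ge 0}$ with $f(t)=k$ (resp. $f(t)\le k$); $F_{=k}(x)=\sum_{t\in\mathbb{Z}_{\ge0}:\,f(t)=k}x^t$ and $F_{\ge k}(x)=\sum_{t\in\mathbb{Z}_{\ge0}:\,f(t)\ge k}x^t$. -}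

module Defs where

open import Data.Nat using (ℕ; zero; suc; _+_; _*_; _∸_; _≤_; _<_; _≤ᵇ_; _≡ᵇ_)
open import Data.Nat.GCD using (gcd)
open import Data.Nat.Divisibility using (_∣?_)
open import Data.Bool using (Bool; true; false; if_then_else_)
open import Data.Fin using (Fin; zero; suc)
open import Data.List as L using (List; []; _∷_)
open import Data.Vec as V using (Vec; []; _∷_; lookup; toList)
open import Data.Product using (Σ; _×_)
open import Data.Integer as ℤ using (ℤ; +_)
open import Relation.Nullary.Decidable using (⌊_⌋)
open import Relation.Binary.PropositionalEquality using (_≡_)

-- The counting function f(a; t) = #{x ∈ ℕⁿ : a₁x₁+⋯+aₙxₙ = t}.
-- Defined by recursion on the coefficient list: the number of solutions
-- equals the sum over the value x of the first variable (with a*x ≤ t)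
-- of the number of solutions for the remaining coefficients and target
-- t - a*x.  Ranging x over 0..t suffices because all coefficients are
-- positive (a ≥ 1 forces x ≤ t).

sumUpTo : (ℕ → ℕ) → ℕ → ℕ
sumUpTo h zero    = h 0
sumUpTo h (suc t) = sumUpTo h t + h (suc t)

countSol : List ℕ → ℕ → ℕ
countSol []       t = if t ≡ᵇ 0 then 1 else 0
countSol (a ∷ as) t =
  sumUpTo (λ x → if a * x ≤ᵇ t then countSol as (t ∸ a * x) else 0) t

f : ∀ {n} → Vec ℕ n → ℕ → ℕ
f a t = countSol (toList a) t

gcdList : List ℕ → ℕ
gcdList = L.foldr gcd 0

removeEntry : ∀ {n} → Vec ℕ n → Fin n → List ℕ
removeEntry (x ∷ xs) zero    = toList xs
removeEntry (x ∷ xs) (suc i) = x ∷ removeEntry xs i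

dd : ∀ {n} → Vec ℕ n → Fin n → ℕ
dd a i = gcdList (removeEntry a i)

pp : ∀ {n} → Vec ℕ n → ℕ
pp a = V.foldr _ _*_ 1 (V.tabulate (dd a))

ΣFin : ∀ {n} → (Fin n → ℕ) → ℕ
ΣFin h = V.sum (V.tabulate h)

IsMax : (ℕ → Bool) → ℕ → Set
IsMax P G = (P G ≡ true) × (∀ t → G < t → P t ≡ false)

IsMin : (ℕ → Bool) → ℕ → Set
IsMin P H = (P H ≡ true) × (∀ t → t < H → P t ≡ false)

countBelow : (ℕ → Bool) → ℕ → ℕ
countBelow P zero    = 0
countBelow P (suc B) = countBelow P B + (if P B then 1 else 0)

sumBelow : (ℕ → Bool) → ℕ → ℕ
sumBelow P zero    = 0
sumBelow P (suc B) = sumBelow P B + (if P B then B else 0)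

HasCount : (ℕ → Bool) → ℕ → Set
HasCount P m = Σ ℕ λ B → (∀ t → B ≤ t → P t ≡ false) × (countBelow P B ≡ m)

HasSum : (ℕ → Bool) → ℕ → Set
HasSum P m = Σ ℕ λ B → (∀ t → B ≤ t → P t ≡ false) × (sumBelow P B ≡ m)

-- Formal power series over ℤ in x, represented by their coefficient
-- sequences.

Series : Set
Series = ℕ → ℤ

sumUpToℤ : (ℕ → ℤ) → ℕ → ℤ
sumUpToℤ h zero    = h 0
sumUpToℤ h (suc t) = sumUpToℤ h t ℤ.+ h (suc t)

_⊛_ : Series → Series → Series
(F ⊛ G) t = sumUpToℤ (λ i → F i ℤ.* G (t ∸ i)) t

infixl 7 _⊛_

_⊖_ : Series → Series → Series
(F ⊖ G) t = F t ℤ.- G t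

xpow : ℕ → Series
xpow m t = if t ≡ᵇ m then + 1 else + 0

oneS : Series
oneS = xpow 0

-- 1/(1 - x^m) for m ≥ 1, i.e. the geometric series Σ_j x^{jm}
-- (the inverse of 1 - x^m in ℤ[[x]]).
invOneMinusXpow : ℕ → Series
invOneMinusXpow m t = if ⌊ m ∣? t ⌋ then + 1 else + 0

ΠFinS : ∀ {n} → (Fin n → Series) → Series
ΠFinS h = V.foldr _ _⊛_ oneS (V.tabulate h)

indicator : (ℕ → Bool) → Series
indicator P t = if P t then + 1 else + 0

prodFactor : ∀ {n} → Vec ℕ n → Series
prodFactor a = ΠFinS λ i → (oneS ⊖ xpow (dd a i * lookup a i)) ⊛ invOneMinusXpow (lookup a i)

{-# OPTIONS --safe #-}
module Submission where

-- Removing the entry aᵢ corresponds to differencing: f(a; t + aᵢ) − f(a; t) = f(a₋ᵢ; t + aᵢ).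
-- The right-hand side vanishes unless dᵢ ∣ t + aᵢ, so f is constant on each block
-- { sp + Σ aᵢ rᵢ : 0 ≤ rᵢ < dᵢ }.  By the Chinese remainder theorem the p elements of a block
-- represent every residue mod p once, so all large t lie in exactly one block.
--
-- It remains to see that s ↦ f(a; sp) is eventually strictly increasing.  Write D_m for the
-- difference operator with step m.  For every g the set of m with D_m g = O(t^(n−3)) is the trace
-- of a subgroup of ℤ.  Applied to g = f(a₋ᵢ; ·) it contains all aⱼ with j ≠ i, hence dᵢ, hence p;
-- so D_{aᵢ} D_p f = O(t^(n−3)) for each i, and as gcd(a) = 1 the same holds for D_m D_p f with any m.
-- Thus a₁ D_p f = D_{a₁p} f + O(t^(n−3)), while at t = sp the term D_{a₁p} f is at least
-- f(a₋₁; (s + a₁)p), which grows like s^(n−2).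

-- The obstacle is strict increase along multiples of p. Raising t by a₁p visibly increases f, but p
-- itself need not be a nonnegative combination of the entries, so no injection of solutions
-- compares f(sp) with f((s+1)p). Bounds on integer sequences and their differences take the place
-- of the leading coefficient of a quasi-polynomial; no partial fractions or rational coefficients
-- enter. Given the increase, every t is sorted as below, in, or above block s, and all the formulas
-- are read off from this trichotomy. The offsets Σ aᵢ rᵢ serve twice: they form the blocks, and
-- they are the exponents of the product of the (1 - x^(dᵢaᵢ)) / (1 - x^(aᵢ)), each occurring once
-- by uniqueness of the digits rᵢ. The series identities thus become equalities of characteristic
-- functions. The cumulative formulas telescope over the blocks from a fixed S on; C₁ and C₂ hold
-- whatever happens before S, which is never evaluated.

open import Defs
open import Data.Bool using (Bool; true; false; if_then_else_; T)
open import Data.Empty using (⊥-elim)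
open import Data.Fin as Fin using (Fin; zero; suc)
open import Data.Integer as ℤ using (ℤ; +_; ∣_∣)
import Data.Integer.Properties as ℤ
import Data.Integer.Tactic.RingSolver as ℤSolver
open import Data.List using (List; []; _∷_; length; map; concatMap)
open import Data.List.Membership.Propositional using (_∈_; find; lose)
open import Data.List.Membership.Propositional.Properties using (∈-map⁺; ∈-map⁻; ∈-concatMap⁺; ∈-concatMap⁻)
open import Data.List.Properties using (map-++)
open import Data.List.Relation.Unary.All as All using (All; []; _∷_)
import Data.List.Relation.Unary.All.Properties as All
open import Data.List.Relation.Unary.Any using (here; there)
open import Data.List.Relation.Unary.Unique.Propositional using (Unique; []; _∷_)
open import Data.List.Relation.Unary.Unique.Propositional.Properties using (map⁺; ++⁺)
open import Data.Nat
open import Data.Nat.Coprimality using (Coprime; coprime-divisor)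
open import Data.Nat.Divisibility
open import Data.Nat.DivMod using (m≡m%n+[m/n]*n; m%n<n; m*n/n≡m; /-monoˡ-≤)
open import Data.Nat.GCD using (gcd; gcd-GCD; module Bézout; gcd[m,n]∣m; gcd[m,n]∣n; gcd-greatest; gcd[m,n]≡0⇒m≡0)
open import Data.Nat.ListAction using (sum; product)
open import Data.Nat.ListAction.Properties using (sum-++; ∈⇒∣product; product≢0)
open import Data.Nat.Properties
open import Data.Nat.Tactic.RingSolver using (solve-∀)
open import Data.Product using (Σ; _×_; _,_; proj₁; proj₂)
open import Data.Sum using (inj₁; inj₂)
open import Data.Vec as V using (Vec; lookup; toList; []; _∷_)
open import Function using (_∘_)
open import Relation.Binary.Definitions using (tri<; tri≈; tri>)
open import Relation.Binary.PropositionalEquality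
open import Relation.Nullary using (¬_; yes; no)
open import Relation.Nullary.Decidable using (⌊_⌋)

-- Shifts and partial sums of sequences

-- Multiplication by x^k on generating functions.
sh : ℕ → (ℕ → ℕ) → ℕ → ℕ
sh zero    g t       = g t
sh (suc k) g zero    = 0
sh (suc k) g (suc t) = sh k g t

sh-cong-≤ : ∀ {g h} k t → (∀ t′ → t′ ≤ t → g t′ ≡ h t′) → sh k g t ≡ sh k h t
sh-cong-≤ zero    t       eq = eq t ≤-refl
sh-cong-≤ (suc k) zero    eq = refl
sh-cong-≤ (suc k) (suc t) eq = sh-cong-≤ k t (λ t′ t′≤t → eq t′ (m≤n⇒m≤1+n t′≤t))

sh-cong : ∀ {g h} → (∀ t → g t ≡ h t) → ∀ k t → sh k g t ≡ sh k h t
sh-cong eq k t = sh-cong-≤ k t (λ t′ _ → eq t′)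

sh-bound : ∀ {g M} k t → (∀ t′ → t′ ≤ t → g t′ ≤ M) → sh k g t ≤ M
sh-bound zero    t       b = b t ≤-refl
sh-bound (suc k) zero    b = z≤n
sh-bound (suc k) (suc t) b = sh-bound k t (λ t′ t′≤t → b t′ (m≤n⇒m≤1+n t′≤t))

sh-sh : ∀ k m g t → sh k (sh m g) t ≡ sh (k + m) g t
sh-sh zero    m g t       = refl
sh-sh (suc k) m g zero    = refl
sh-sh (suc k) m g (suc t) = sh-sh k m g t

sh-comm : ∀ k m g t → sh k (sh m g) t ≡ sh m (sh k g) t
sh-comm k m g t = trans (sh-sh k m g t)
  (trans (cong (λ j → sh j g t) (+-comm k m)) (sym (sh-sh m k g t)))

sh-+ : ∀ k g h t → sh k (λ t → g t + h t) t ≡ sh k g t + sh k h t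
sh-+ zero    g h t       = refl
sh-+ (suc k) g h zero    = refl
sh-+ (suc k) g h (suc t) = sh-+ k g h t

sh-zero : ∀ k t → sh k (λ _ → 0) t ≡ 0
sh-zero zero    t       = refl
sh-zero (suc k) zero    = refl
sh-zero (suc k) (suc t) = sh-zero k t

sh-at : ∀ k g t → sh k g (k + t) ≡ g t
sh-at zero    g t = refl
sh-at (suc k) g t = sh-at k g t

sh-> : ∀ {k t} g → t < k → sh k g t ≡ 0
sh-> {suc k} {zero}  g _         = refl
sh-> {suc k} {suc t} g (s≤s t<k) = sh-> g t<k

sh-if : ∀ k g t → (if k ≤ᵇ t then g (t ∸ k) else 0) ≡ sh k g t
sh-if zero          g t       = refl
sh-if (suc k)       g zero    = refl
sh-if (suc zero)    g (suc t) = refl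
sh-if (suc (suc k)) g (suc t) = sh-if (suc k) g t

sumUpTo-cong : ∀ {g h} t → (∀ i → i ≤ t → g i ≡ h i) → sumUpTo g t ≡ sumUpTo h t
sumUpTo-cong zero    eq = eq 0 z≤n
sumUpTo-cong (suc t) eq =
  cong₂ _+_ (sumUpTo-cong t (λ i i≤t → eq i (m≤n⇒m≤1+n i≤t))) (eq (suc t) ≤-refl)

interchange : ∀ a b c d → (a + b) + (c + d) ≡ (a + c) + (b + d)
interchange = solve-∀

sumUpTo-+ : ∀ g h t → sumUpTo (λ i → g i + h i) t ≡ sumUpTo g t + sumUpTo h t
sumUpTo-+ g h zero    = refl
sumUpTo-+ g h (suc t) = trans (cong (_+ (g (suc t) + h (suc t))) (sumUpTo-+ g h t))
  (interchange (sumUpTo g t) (sumUpTo h t) (g (suc t)) (h (suc t)))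

sumUpTo-suc : ∀ h t → sumUpTo h (suc t) ≡ h 0 + sumUpTo (λ i → h (suc i)) t
sumUpTo-suc h zero    = refl
sumUpTo-suc h (suc t) = trans (cong (_+ h (suc (suc t))) (sumUpTo-suc h t)) (+-assoc (h 0) _ _)

sumUpTo-extend : ∀ h t k → (∀ i → t < i → h i ≡ 0) → sumUpTo h (k + t) ≡ sumUpTo h t
sumUpTo-extend h t zero    z = refl
sumUpTo-extend h t (suc k) z =
  trans (cong₂ _+_ (sumUpTo-extend h t k z) (z (suc k + t) (s≤s (m≤n+m t k)))) (+-identityʳ _)

sumUpTo-bound : ∀ h M t → (∀ i → i ≤ t → h i ≤ M) → sumUpTo h t ≤ suc t * M
sumUpTo-bound h M zero    b = ≤-trans (b 0 z≤n) (≤-reflexive (sym (+-identityʳ M)))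
sumUpTo-bound h M (suc t) b = ≤-trans
  (+-mono-≤ (sumUpTo-bound h M t (λ i i≤t → b i (m≤n⇒m≤1+n i≤t))) (b (suc t) ≤-refl))
  (≤-reflexive (+-comm (suc t * M) M))

≤-sumUpTo : ∀ h {i t} → i ≤ t → h i ≤ sumUpTo h t
≤-sumUpTo h {zero} {zero}  _ = ≤-refl
≤-sumUpTo h {i}    {suc t} i≤t with i ≟ suc t
... | yes refl = m≤n+m _ _
... | no  i≢t  = ≤-trans (≤-sumUpTo h (≤-pred (≤∧≢⇒< i≤t i≢t))) (m≤m+n _ _)

sumUpTo-zero : ∀ {h} t → (∀ i → i ≤ t → h i ≡ 0) → sumUpTo h t ≡ 0
sumUpTo-zero zero    z = z 0 z≤n
sumUpTo-zero (suc t) z =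
  cong₂ _+_ (sumUpTo-zero t (λ i i≤t → z i (m≤n⇒m≤1+n i≤t))) (z (suc t) ≤-refl)

sumUpTo-single : ∀ {h} t j → j ≤ t → (∀ i → i ≤ t → i ≢ j → h i ≡ 0) → sumUpTo h t ≡ h j
sumUpTo-single zero    zero j≤t z = refl
sumUpTo-single {h} (suc t) j j≤t z with j ≟ suc t
... | yes refl = cong (_+ h (suc t)) (sumUpTo-zero t
                   (λ i i≤t → z i (m≤n⇒m≤1+n i≤t) (<⇒≢ (s≤s i≤t))))
... | no  j≢t  = trans (cong₂ _+_
                   (sumUpTo-single t j (≤-pred (≤∧≢⇒< j≤t j≢t)) (λ i i≤t → z i (m≤n⇒m≤1+n i≤t)))
                   (z (suc t) ≤-refl (λ eq → j≢t (sym eq)))) (+-identityʳ _)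

sh-sumUpTo : ∀ k (G : ℕ → ℕ → ℕ) N t →
             sh k (λ t → sumUpTo (λ i → G i t) N) t ≡ sumUpTo (λ i → sh k (G i) t) N
sh-sumUpTo k G zero    t = refl
sh-sumUpTo k G (suc N) t = trans (sh-+ k (λ t → sumUpTo (λ i → G i t) N) (G (suc N)) t)
  (cong (_+ sh k (G (suc N)) t) (sh-sumUpTo k G N t))

-- The recursion for removing one entry

partialSol : ℕ → List ℕ → ℕ → ℕ → ℕ
partialSol x cs N t = sumUpTo (λ i → sh (x * i) (countSol cs) t) N

countSol≡partialSol : ∀ x cs t → countSol (x ∷ cs) t ≡ partialSol x cs t t
countSol≡partialSol x cs t = sumUpTo-cong t (λ i _ → sh-if (x * i) (countSol cs) t)

-- The cutoff `N` is kept apart from `t` so that `sh` can act on `t` under a fixed range of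
-- summation. Surplus summands vanish because i > t forces x * i > t.
partialSol-saturates : ∀ x cs {N t} → 0 < x → t ≤ N → partialSol x cs N t ≡ countSol (x ∷ cs) t
partialSol-saturates x@(suc _) cs {N} {t} _ t≤N = trans
  (trans (cong (λ M → partialSol x cs M t) (sym (m∸n+n≡m t≤N)))
         (sumUpTo-extend _ t (N ∸ t)
           (λ i t<i → sh-> (countSol cs) (<-≤-trans t<i (m≤n*m i x)))))
  (sym (countSol≡partialSol x cs t))

-- A relation on lists rather than an index: the inductions on `countSol` follow its two
-- constructors, and repeated removal needs no index arithmetic.
data Rem (x : ℕ) : List ℕ → List ℕ → Set where
  here  : ∀ {cs} → Rem x (x ∷ cs) cs
  there : ∀ {y cs cs′} → Rem x cs cs′ → Rem x (y ∷ cs) (y ∷ cs′)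

Positive : List ℕ → Set
Positive = All (0 <_)

-- As generating functions, (1 - X^x) F_cs = F_cs′. If x is the head, the geometric series loses all
-- but its zeroth term; otherwise the identity passes through the summation over the head `y`,
-- because shifts commute. Stating it with `sh` includes the arguments t < x, which the second case
-- needs.
countSol-Rem : ∀ {x cs cs′} → Positive cs → Rem x cs cs′ →
               ∀ t → countSol cs t ≡ sh x (countSol cs) t + countSol cs′ t
countSol-Rem {x} {cs} (px ∷ _) (here {cs′}) t = begin
  countSol cs t
    -- The range is enlarged by one so that splitting off the summand i = 0 leaves a sum over 0..t
    -- again.
    ≡⟨ partialSol-saturates x cs′ px (n≤1+n t) ⟨
  partialSol x cs′ (suc t) t
    ≡⟨ sumUpTo-suc _ t ⟩
  sh (x * 0) (countSol cs′) t + sumUpTo (λ i → sh (x * suc i) (countSol cs′) t) t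
    ≡⟨ cong₂ _+_ (cong (λ k → sh k (countSol cs′) t) (*-zeroʳ x))
         (sumUpTo-cong t (λ i _ → trans (cong (λ k → sh k (countSol cs′) t) (*-suc x i))
                                        (sym (sh-sh x (x * i) (countSol cs′) t)))) ⟩
  countSol cs′ t + sumUpTo (λ i → sh x (sh (x * i) (countSol cs′)) t) t
    ≡⟨ cong (λ z → countSol cs′ t + z) (sh-sumUpTo x (λ i → sh (x * i) (countSol cs′)) t t) ⟨
  countSol cs′ t + sh x (partialSol x cs′ t) t
    ≡⟨ cong (λ z → countSol cs′ t + z) (sh-cong-≤ x t (λ t′ → partialSol-saturates x cs′ px)) ⟩
  countSol cs′ t + sh x (countSol cs) t
    ≡⟨ +-comm (countSol cs′ t) _ ⟩
  sh x (countSol cs) t + countSol cs′ t ∎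
  where open ≡-Reasoning
countSol-Rem {x} {cs} (py ∷ pcs) (there {y} {ds} {ds′} r) t = begin
  countSol cs t
    ≡⟨ countSol≡partialSol y ds t ⟩
  sumUpTo (λ i → sh (y * i) (countSol ds) t) t
    ≡⟨ sumUpTo-cong t (λ i _ → trans (sh-cong (countSol-Rem pcs r) (y * i) t)
         (trans (sh-+ (y * i) (sh x (countSol ds)) (countSol ds′) t)
           (cong (_+ sh (y * i) (countSol ds′) t) (sh-comm (y * i) x (countSol ds) t)))) ⟩
  sumUpTo (λ i → sh x (sh (y * i) (countSol ds)) t + sh (y * i) (countSol ds′) t) t
    ≡⟨ sumUpTo-+ _ _ t ⟩
  sumUpTo (λ i → sh x (sh (y * i) (countSol ds)) t) t + sumUpTo (λ i → sh (y * i) (countSol ds′) t) t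
    ≡⟨ cong₂ _+_ (trans (sym (sh-sumUpTo x (λ i → sh (y * i) (countSol ds)) t t))
                        (sh-cong-≤ x t (λ t′ → partialSol-saturates y ds py)))
                 (sym (countSol≡partialSol y ds′ t)) ⟩
  sh x (countSol cs) t + countSol (y ∷ ds′) t ∎
  where open ≡-Reasoning

countSol-step : ∀ {x cs cs′} → Positive cs → Rem x cs cs′ →
                ∀ t → countSol cs (x + t) ≡ countSol cs t + countSol cs′ (x + t)
countSol-step {x} {cs} {cs′} pos r t = trans (countSol-Rem pos r (x + t))
  (cong (_+ countSol cs′ (x + t)) (sh-at x (countSol cs) t))

-- Polynomial upper bounds for the counting function

countSol-singleton : ∀ x → 0 < x → ∀ N t → t ≤ N → countSol (x ∷ []) t ≤ 1
countSol-singleton (suc x) px N zero t≤N = ≤-reflexive (countSol-Rem (px ∷ []) here 0)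
-- `N` bounds `t` and carries the recursion: as the entry is a successor, the shift only looks at
-- arguments up to `t`.
countSol-singleton (suc x) px (suc N) (suc t) (s≤s t≤N) =
  ≤-trans (≤-reflexive (trans (countSol-Rem (px ∷ []) here (suc t)) (+-identityʳ _)))
    (sh-bound x t (λ t′ t′≤t → countSol-singleton (suc x) px N t′ (≤-trans t′≤t t≤N)))

-- Each variable but the last has at most t + 1 values, and the last is then determined. Hence the
-- exponent n - 1 for n entries.
countSol-≤ : ∀ c cs → Positive (c ∷ cs) → ∀ t → countSol (c ∷ cs) t ≤ suc t ^ length cs
countSol-≤ c []       (pc ∷ _)  t = countSol-singleton c pc t t ≤-refl
countSol-≤ c (x ∷ cs) (_ ∷ pos) t = ≤-trans (≤-reflexive (countSol≡partialSol c (x ∷ cs) t))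
  (sumUpTo-bound _ (suc t ^ length cs) t (λ i _ → sh-bound (c * i) t
    (λ t′ t′≤t → ≤-trans (countSol-≤ x cs pos t′) (^-monoˡ-≤ (length cs) (s≤s t′≤t)))))

-- In this form the bound includes the empty list, whose count is 1 at t = 0 and 0 afterwards. That
-- case occurs when two entries are removed from a vector of length 2.
suc*countSol-≤ : ∀ cs → Positive cs → ∀ t → suc t * countSol cs t ≤ suc t ^ length cs
suc*countSol-≤ []       pos zero    = ≤-refl
suc*countSol-≤ []       pos (suc t) = ≤-trans (≤-reflexive (*-zeroʳ t)) z≤n
suc*countSol-≤ (c ∷ cs) pos t       = *-monoʳ-≤ (suc t) (countSol-≤ c cs pos t)

-- Submonoids of ℕ and traces of subgroups of ℤ

record Submonoid (P : ℕ → Set) : Set where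
  field
    zero∈ : P 0
    +∈    : ∀ {m n} → P m → P n → P (m + n)

  *∈ : ∀ {m} k → P m → P (k * m)
  *∈ zero    Pm = zero∈
  *∈ (suc k) Pm = +∈ Pm (*∈ k Pm)

  ∣∈ : ∀ {m n} → m ∣ n → P m → P n
  ∣∈ (divides k refl) Pm = *∈ k Pm

-- The trace on ℕ of a subgroup of ℤ.
record Subgroup (P : ℕ → Set) : Set where
  field
    submonoid : Submonoid P
    cancel    : ∀ {m n} → P m → P (n + m) → P n
  open Submonoid submonoid public

  -- Over ℕ the Bézout identity reads d + y n = x m, or the same with m and n exchanged; `cancel`
  -- stands in for the subtraction.
  gcd∈ : ∀ {m n} → P m → P n → P (gcd m n)
  gcd∈ {m} {n} Pm Pn with Bézout.identity (gcd-GCD m n)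
  ... | Bézout.+- x y eq = cancel (*∈ y Pn) (subst P (sym eq) (*∈ x Pm))
  ... | Bézout.-+ x y eq = cancel (*∈ x Pm) (subst P (sym eq) (*∈ y Pn))

  gcdList∈ : ∀ {cs} → (∀ {x cs′} → Rem x cs cs′ → P x) → P (gcdList cs)
  gcdList∈ {[]}     h = zero∈
  gcdList∈ {x ∷ cs} h = gcd∈ (h here) (gcdList∈ (λ r → h (there r)))

-- Modulo A, the residues of a submonoid form a subgroup, because −y ≡ (A − 1) y.
mod-subgroup : ∀ {Q} A → 0 < A → Submonoid Q → Subgroup (λ y → Σ ℕ λ x → Q (y + x * A))
mod-subgroup {Q} A@(suc A′) _ Q-sub = record
  { submonoid = record
    { zero∈ = 0 , Q.zero∈
    ; +∈    = λ { {m} {n} (x , Qm) (y , Qn) → x + y , subst Q (add m n x y A) (Q.+∈ Qm Qn) }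
    }
  ; cancel = λ { {m} {n} (x , Qm) (y , Qn) →
      m + A′ * x + y , subst Q (sub m n x y A′) (Q.+∈ (Q.*∈ A′ Qm) Qn) }
  }
  where
  module Q = Submonoid Q-sub
  add : ∀ m n x y A → (m + x * A) + (n + y * A) ≡ (m + n) + (x + y) * A
  add = solve-∀
  sub : ∀ m n x y A → A * (m + x * suc A) + ((n + m) + y * suc A) ≡ n + (m + A * x + y) * suc A
  sub = solve-∀

-- Sequences of bounded order and difference operators

-- g = O(t^(N−1)); the factor suc t keeps the case N = 0, needed for n = 2, meaningful.
record Small (N : ℕ) (g : ℕ → ℤ) : Set where
  constructor small
  field
    coeff onset : ℕ
    bound       : ∀ t → onset ≤ t → suc t * ∣ g t ∣ ≤ coeff * suc t ^ N

suc-+-≤ : ∀ k t → suc (k + t) ≤ suc k * suc t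
suc-+-≤ k t = subst (suc (k + t) ≤_) (sym (eq k t)) (m≤m+n _ _)
  where
  eq : ∀ k t → suc k * suc t ≡ suc (k + t) + k * t
  eq = solve-∀

^-*-distrib : ∀ m n o → (m * n) ^ o ≡ m ^ o * n ^ o
^-*-distrib m n zero    = refl
^-*-distrib m n (suc o) = trans (cong (m * n *_) (^-*-distrib m n o)) (eq m n (m ^ o) (n ^ o))
  where
  eq : ∀ m n x y → m * n * (x * y) ≡ m * x * (n * y)
  eq = solve-∀

module _ {N : ℕ} where

  Small-cong : ∀ {g h} → (∀ t → g t ≡ h t) → Small N g → Small N h
  Small-cong eq (small C T b) = small C T λ t T≤t →
    subst (λ z → suc t * ∣ z ∣ ≤ C * suc t ^ N) (eq t) (b t T≤t)

  Small-0 : Small N (λ _ → + 0)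
  Small-0 = small 0 0 λ t _ → ≤-reflexive (*-zeroʳ (suc t))

  Small-+ : ∀ {g h} → Small N g → Small N h → Small N (λ t → g t ℤ.+ h t)
  Small-+ {g} {h} (small C T b) (small C′ T′ b′) = small (C + C′) (T + T′) λ t TT≤t → begin
    suc t * ∣ g t ℤ.+ h t ∣
      ≤⟨ *-monoʳ-≤ (suc t) (ℤ.∣i+j∣≤∣i∣+∣j∣ (g t) (h t)) ⟩
    suc t * (∣ g t ∣ + ∣ h t ∣)
      ≡⟨ *-distribˡ-+ (suc t) ∣ g t ∣ ∣ h t ∣ ⟩
    suc t * ∣ g t ∣ + suc t * ∣ h t ∣
      ≤⟨ +-mono-≤ (b t (≤-trans (m≤m+n T T′) TT≤t)) (b′ t (≤-trans (m≤n+m T′ T) TT≤t)) ⟩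
    C * suc t ^ N + C′ * suc t ^ N
      ≡⟨ *-distribʳ-+ (suc t ^ N) C C′ ⟨
    (C + C′) * suc t ^ N ∎
    where open ≤-Reasoning

  Small-neg : ∀ {g} → Small N g → Small N (λ t → ℤ.- g t)
  Small-neg {g} (small C T b) = small C T λ t T≤t →
    subst (λ z → suc t * z ≤ C * suc t ^ N) (sym (ℤ.∣-i∣≡∣i∣ (g t))) (b t T≤t)

  Small-shift : ∀ {g} k → Small N g → Small N (λ t → g (k + t))
  Small-shift {g} k (small C T b) = small (C * suc k ^ N) T λ t T≤t → begin
    suc t * ∣ g (k + t) ∣       ≤⟨ *-monoˡ-≤ ∣ g (k + t) ∣ (s≤s (m≤n+m t k)) ⟩
    suc (k + t) * ∣ g (k + t) ∣ ≤⟨ b (k + t) (≤-trans T≤t (m≤n+m t k)) ⟩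
    C * suc (k + t) ^ N         ≤⟨ *-monoʳ-≤ C (^-monoˡ-≤ N (suc-+-≤ k t)) ⟩
    C * (suc k * suc t) ^ N     ≡⟨ cong (C *_) (^-*-distrib (suc k) (suc t) N) ⟩
    C * (suc k ^ N * suc t ^ N) ≡⟨ *-assoc C _ _ ⟨
    C * suc k ^ N * suc t ^ N   ∎
    where open ≤-Reasoning

  -- Only eventual bounds are recorded: raising the onset past `k` discards the values that the
  -- shift does not see, and 1 + k + t ≤ (1 + k)(1 + t) adjusts the factor in front.
  Small-unshift : ∀ {g} k → Small N (λ t → g (k + t)) → Small N g
  Small-unshift {g} k (small C T b) = small (suc k * C) (k + T) λ t kT≤t →
    subst (λ t → suc t * ∣ g t ∣ ≤ suc k * C * suc t ^ N) (m+[n∸m]≡n (≤-trans (m≤m+n k T) kT≤t))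
      (bound′ (t ∸ k) (subst (_≤ t ∸ k) (m+n∸m≡n k T) (∸-monoˡ-≤ k kT≤t)))
    where
    open ≤-Reasoning
    bound′ : ∀ t → T ≤ t → suc (k + t) * ∣ g (k + t) ∣ ≤ suc k * C * suc (k + t) ^ N
    bound′ t T≤t = begin
      suc (k + t) * ∣ g (k + t) ∣     ≤⟨ *-monoˡ-≤ ∣ g (k + t) ∣ (suc-+-≤ k t) ⟩
      suc k * suc t * ∣ g (k + t) ∣   ≡⟨ *-assoc (suc k) (suc t) _ ⟩
      suc k * (suc t * ∣ g (k + t) ∣) ≤⟨ *-monoʳ-≤ (suc k) (b t T≤t) ⟩
      suc k * (C * suc t ^ N)         ≤⟨ *-monoʳ-≤ (suc k) (*-monoʳ-≤ C (^-monoˡ-≤ N (s≤s (m≤n+m t k)))) ⟩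
      suc k * (C * suc (k + t) ^ N)   ≡⟨ *-assoc (suc k) C _ ⟨
      suc k * C * suc (k + t) ^ N     ∎

diff : ℕ → (ℕ → ℤ) → ℕ → ℤ
diff m g t = g (m + t) ℤ.- g t

diff-+ : ∀ m n g t → diff (m + n) g t ≡ diff m g (n + t) ℤ.+ diff n g t
diff-+ m n g t = trans (cong (λ u → g u ℤ.- g t) (+-assoc m n t)) (eq (g (m + (n + t))) (g (n + t)) (g t))
  where
  eq : ∀ x y z → x ℤ.- z ≡ (x ℤ.- y) ℤ.+ (y ℤ.- z)
  eq = ℤSolver.solve-∀

diff-comm : ∀ m n g t → diff m (diff n g) t ≡ diff n (diff m g) t
diff-comm m n g t = trans
  (cong (λ u → (g u ℤ.- g (m + t)) ℤ.- (g (n + t) ℤ.- g t)) (swap n m t))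
  (eq (g (m + (n + t))) (g (m + t)) (g (n + t)) (g t))
  where
  swap : ∀ a b c → a + (b + c) ≡ b + (a + c)
  swap = solve-∀
  eq : ∀ x y z w → (x ℤ.- y) ℤ.- (z ℤ.- w) ≡ (x ℤ.- z) ℤ.- (y ℤ.- w)
  eq = ℤSolver.solve-∀

-- Both closure properties come from the cocycle identity `diff-+`. In `cancel` it controls
-- `diff n g` only at the shifted argument m + t, hence `Small-unshift`.
small-periods : ∀ {N} g → Subgroup (λ m → Small N (diff m g))
small-periods g = record
  { submonoid = record
    { zero∈ = Small-cong (λ t → sym (ℤ.+-inverseʳ (g t))) Small-0
    ; +∈    = λ {m} {n} Sm Sn →
        Small-cong (λ t → sym (diff-+ m n g t)) (Small-+ (Small-shift n Sm) Sn)
    }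
  ; cancel = λ {m} {n} Sm Snm → Small-unshift m (Small-cong
      (λ t → trans (cong (ℤ._- diff m g t) (diff-+ n m g t)) (eq (diff n g (m + t)) (diff m g t)))
      (Small-+ Snm (Small-neg Sm)))
  }
  where
  eq : ∀ x y → (x ℤ.+ y) ℤ.- y ≡ x
  eq = ℤSolver.solve-∀

-- Approximate periods of the counting function

Rem-length : ∀ {x cs cs′} → Rem x cs cs′ → length cs ≡ suc (length cs′)
Rem-length here      = refl
Rem-length (there r) = cong suc (Rem-length r)

Rem-positive : ∀ {x cs cs′} → Rem x cs cs′ → Positive cs → Positive cs′
Rem-positive here      (_ ∷ pos)  = pos
Rem-positive (there r) (py ∷ pos) = py ∷ Rem-positive r pos

+countSol : List ℕ → ℕ → ℤ
+countSol cs t = + countSol cs t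

diff-countSol : ∀ {x cs cs′} → Positive cs → Rem x cs cs′ →
                ∀ t → diff x (+countSol cs) t ≡ +countSol cs′ (x + t)
diff-countSol {x} {cs} {cs′} pos r t = trans
  (cong (λ z → + z ℤ.- + countSol cs t) (countSol-step pos r t))
  (trans (cong (ℤ._- + countSol cs t) (ℤ.pos-+ (countSol cs t) (countSol cs′ (x + t))))
         (eq (+ countSol cs t) (+ countSol cs′ (x + t))))
  where
  eq : ∀ x y → (x ℤ.+ y) ℤ.- x ≡ y
  eq = ℤSolver.solve-∀

Small-countSol : ∀ {cs} → Positive cs → Small (length cs) (+countSol cs)
Small-countSol {cs} pos = small 1 0 λ t _ →
  ≤-trans (suc*countSol-≤ cs pos t) (≤-reflexive (sym (+-identityʳ _)))

-- Differencing by an entry removes it and lowers the order by one. So every entry is a period up to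
-- O(t^(N-1)), and such periods are closed under gcd.
gcdList-period : ∀ {N cs} → Positive cs → length cs ≡ suc N →
                 Small N (diff (gcdList cs) (+countSol cs))
gcdList-period {N} {cs} pos len = Subgroup.gcdList∈ (small-periods (+countSol cs))
  (λ {x} {cs′} r → Small-cong (λ t → sym (diff-countSol pos r t))
    (Small-shift x (subst (λ M → Small M (+countSol cs′))
      (suc-injective (trans (sym (Rem-length r)) len)) (Small-countSol (Rem-positive r pos)))))

module _ {N cs p} (pos : Positive cs) (len : length cs ≡ suc (suc N)) (gcd≡1 : gcdList cs ≡ 1)
         (gcd∣p : ∀ {x cs′} → Rem x cs cs′ → gcdList cs′ ∣ p) where

  private
    F = +countSol cs
    module Periods = Subgroup (small-periods {N} (diff p F))

  entry-period : ∀ {x cs′} → Rem x cs cs′ → Small N (diff x (diff p F))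
  entry-period {x} {cs′} r = Small-cong
    (λ t → trans (cong (λ u → + countSol cs′ u ℤ.- + countSol cs′ (x + t)) (swap p x t))
      (trans (cong₂ ℤ._-_ (sym (diff-countSol pos r (p + t))) (sym (diff-countSol pos r t)))
             (diff-comm p x F t)))
    (Small-shift x (Subgroup.∣∈ (small-periods (+countSol cs′)) (gcd∣p r)
      (gcdList-period (Rem-positive r pos) (suc-injective (trans (sym (Rem-length r)) len)))))
    where
    swap : ∀ a b c → a + (b + c) ≡ b + (a + c)
    swap = solve-∀

  every-period : ∀ m → Small N (diff m (diff p F))
  every-period m = Periods.∣∈ (1∣ m)
    (subst (λ d → Small N (diff d (diff p F))) gcd≡1 (Periods.gcdList∈ entry-period))

  -- D_(kp) F(t) is the sum of D_p F(t + jp) over j < k, and each summand differs from D_p F(t) by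
  -- D_(jp) D_p F(t), which `every-period` bounds.
  diff-multiple : ∀ k → Small N (λ t → diff (k * p) F t ℤ.- + k ℤ.* diff p F t)
  diff-multiple zero    = Small-cong
    (λ t → sym (cong (ℤ._+ + 0) (ℤ.+-inverseʳ (F t)))) Small-0
  diff-multiple (suc k) = Small-cong
    (λ t → sym (trans (cong (ℤ._- + suc k ℤ.* diff p F t) (diff-+ p (k * p) F t))
      (eq (diff p F (k * p + t)) (diff (k * p) F t) (+ k) (diff p F t))))
    (Small-+ (every-period (k * p)) (diff-multiple k))
    where
    eq : ∀ x y k z → (x ℤ.+ y) ℤ.- ((+ 1 ℤ.+ k) ℤ.* z) ≡ (x ℤ.- z) ℤ.+ (y ℤ.- k ℤ.* z)
    eq = ℤSolver.solve-∀

-- Polynomial lower bounds along multiples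

Raises : (ℕ → ℕ) → ℕ → Set
Raises g v = ∀ t → g t ≤ g (v + t)

-- All entries raise `countSol`. Through `mod-subgroup` it follows that some P + x A raises it
-- whenever the gcd of the entries divides P, even if P itself is not a combination of entries.
Raises-submonoid : ∀ g → Submonoid (Raises g)
Raises-submonoid g = record
  { zero∈ = λ t → ≤-refl
  ; +∈    = λ {m} {n} Rm Rn t →
      ≤-trans (Rn t) (≤-trans (Rm (n + t)) (≤-reflexive (cong g (sym (+-assoc m n t)))))
  }

Raises-entry : ∀ {x cs cs′} → Positive cs → Rem x cs cs′ → Raises (countSol cs) x
Raises-entry pos r t = ≤-trans (m≤m+n _ _) (≤-reflexive (sym (countSol-step pos r t)))

-- The first k - 1 steps of length x only preserve the lower bound; the last one contributes the
-- count without x.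
countSol-multiple : ∀ {x cs cs′} → Positive cs → Rem x cs cs′ → ∀ k → 0 < k → ∀ t →
                    countSol cs t + countSol cs′ (k * x + t) ≤ countSol cs (k * x + t)
countSol-multiple {x} {cs} {cs′} pos r (suc k) _ t = begin
  countSol cs t + countSol cs′ (x + k * x + t)
    ≤⟨ +-monoˡ-≤ _ (Submonoid.*∈ (Raises-submonoid (countSol cs)) k (Raises-entry pos r) t) ⟩
  countSol cs (k * x + t) + countSol cs′ (x + k * x + t)
    ≡⟨ cong (λ u → countSol cs (k * x + t) + countSol cs′ u) (+-assoc x (k * x) t) ⟩
  countSol cs (k * x + t) + countSol cs′ (x + (k * x + t))
    ≡⟨ countSol-step pos r (k * x + t) ⟨
  countSol cs (x + (k * x + t))
    ≡⟨ cong (countSol cs) (+-assoc x (k * x) t) ⟨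
  countSol cs (x + k * x + t) ∎
  where open ≤-Reasoning

-- Write z = j + z₀ with z₀ = q 2^l. Each of the last j steps of length A adds at least q^l by
-- induction on the list, and z ≥ 2 z₀ gives j ≥ z₀ ≥ q. The power of 2 comes from this halving at
-- every entry.
countSol-at-multiples : ∀ {A} → 0 < A → ∀ c cs → Positive (c ∷ cs) → All (_∣ A) (c ∷ cs) →
  ∀ q z → q * 2 ^ length cs ≤ z → q ^ length cs ≤ countSol (c ∷ cs) (z * A)
countSol-at-multiples _ c [] pos@(pc ∷ []) (divides k refl ∷ []) q z _ = begin
  1                               ≡⟨ at-0 c pc ⟨
  countSol (c ∷ []) 0             ≤⟨ Submonoid.*∈ (Raises-submonoid (countSol (c ∷ []))) z
                                      (Submonoid.*∈ (Raises-submonoid (countSol (c ∷ []))) k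
                                        (Raises-entry pos here)) 0 ⟩
  countSol (c ∷ []) (z * (k * c) + 0) ≡⟨ cong (countSol (c ∷ [])) (+-identityʳ (z * (k * c))) ⟩
  countSol (c ∷ []) (z * (k * c)) ∎
  where
  open ≤-Reasoning
  at-0 : ∀ c → 0 < c → countSol (c ∷ []) 0 ≡ 1
  at-0 (suc c) pc = countSol-Rem (pc ∷ []) here 0
countSol-at-multiples {A} A>0 c (x ∷ cs) pos@(pc ∷ pxcs) (divides k eqA ∷ x∣A ∷ cs∣A) q z qz≤z =
  ≤-trans (*-monoˡ-≤ (q ^ l) q≤j)
    (subst (λ u → j * q ^ l ≤ countSol (c ∷ x ∷ cs) (u * A)) (m∸n+n≡m z₀≤z) (accumulate j))
  where
  open ≤-Reasoning
  l  = length cs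
  z₀ = q * 2 ^ l
  j  = z ∸ z₀
  2z₀≤z : z₀ + z₀ ≤ z
  2z₀≤z = ≤-trans (≤-reflexive (eq q (2 ^ l))) qz≤z
    where
    eq : ∀ q y → q * y + q * y ≡ q * (2 * y)
    eq = solve-∀
  z₀≤z : z₀ ≤ z
  z₀≤z = ≤-trans (m≤m+n z₀ z₀) 2z₀≤z
  q≤j : q ≤ j
  q≤j = ≤-trans (m≤m*n q (2 ^ l) ⦃ m^n≢0 2 l ⦄)
    (subst (_≤ j) (m+n∸n≡m z₀ z₀) (∸-monoˡ-≤ z₀ 2z₀≤z))
  k>0 : ∀ k → A ≡ k * c → 0 < k
  k>0 zero    refl = A>0
  k>0 (suc k) _    = z<s
  accumulate : ∀ j → j * q ^ l ≤ countSol (c ∷ x ∷ cs) ((j + z₀) * A)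
  accumulate zero    = z≤n
  accumulate (suc j) = begin
    q ^ l + j * q ^ l
      ≡⟨ +-comm (q ^ l) _ ⟩
    j * q ^ l + q ^ l
      ≤⟨ +-mono-≤ (accumulate j)
           (countSol-at-multiples A>0 x cs pxcs (x∣A ∷ cs∣A) q (suc j + z₀) (m≤n+m z₀ (suc j))) ⟩
    countSol (c ∷ x ∷ cs) ((j + z₀) * A) + countSol (x ∷ cs) (A + (j + z₀) * A)
      ≡⟨ cong (λ B → countSol (c ∷ x ∷ cs) ((j + z₀) * A) + countSol (x ∷ cs) (B + (j + z₀) * A)) eqA ⟩
    countSol (c ∷ x ∷ cs) ((j + z₀) * A) + countSol (x ∷ cs) (k * c + (j + z₀) * A)
      ≤⟨ countSol-multiple pos here k (k>0 k eqA) ((j + z₀) * A) ⟩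
    countSol (c ∷ x ∷ cs) (k * c + (j + z₀) * A)
      ≡⟨ cong (λ B → countSol (c ∷ x ∷ cs) (B + (j + z₀) * A)) eqA ⟨
    countSol (c ∷ x ∷ cs) ((suc j + z₀) * A) ∎

-- Multiples of the product A of the entries are settled by `countSol-at-multiples`. With s = s′ +
-- z′ A, the point s P is reached from (z′ P - s′ x) A by adding s′ times the raising number P + x
-- A.
countSol-growth : ∀ {P} → 0 < P → ∀ c cs → Positive (c ∷ cs) → gcdList (c ∷ cs) ∣ P →
  Σ ℕ λ K → 0 < K × (∀ q s → suc q * K ≤ s → q ^ length cs ≤ countSol (c ∷ cs) (s * P))
countSol-growth {P} P>0 c cs pos gcd∣P = K , K>0 , grow
  where
  A = product (c ∷ cs)
  instance
    A≢0 : NonZero A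
    A≢0 = product≢0 (All.map >-nonZero pos)
    P≢0 : NonZero P
    P≢0 = >-nonZero P>0
  module Up = Submonoid (Raises-submonoid (countSol (c ∷ cs)))
  module Mod = Subgroup (mod-subgroup A (>-nonZero⁻¹ A) (Raises-submonoid (countSol (c ∷ cs))))
  l = length cs
  P-up : Σ ℕ λ x → Raises (countSol (c ∷ cs)) (P + x * A)
  P-up = Mod.∣∈ gcd∣P (Mod.gcdList∈ (λ {y} r →
    0 , subst (Raises (countSol (c ∷ cs))) (sym (+-identityʳ y)) (Raises-entry pos r)))
  x = proj₁ P-up
  -- The first summand provides q 2^l, the second covers s′ x, where s′ < A. The factor `suc q` in
  -- `grow` keeps the second part available at q = 0.
  R = 2 ^ l + A * x
  K = R * A
  K>0 : 0 < K
  K>0 = *-mono-≤ (≤-trans (m^n>0 2 l) (m≤m+n (2 ^ l) (A * x))) (>-nonZero⁻¹ A)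
  grow : ∀ q s → suc q * K ≤ s → q ^ l ≤ countSol (c ∷ cs) (s * P)
  grow q s qK≤s = begin
    q ^ l
      ≤⟨ countSol-at-multiples (>-nonZero⁻¹ A) c cs pos (All.tabulate ∈⇒∣product)
           q (z′ * P ∸ s′ * x) (m+n≤o⇒m≤o∸n _ enough) ⟩
    countSol (c ∷ cs) ((z′ * P ∸ s′ * x) * A)
      ≤⟨ Up.*∈ s′ (proj₂ P-up) _ ⟩
    countSol (c ∷ cs) (s′ * (P + x * A) + (z′ * P ∸ s′ * x) * A)
      ≡⟨ cong (countSol (c ∷ cs)) split ⟩
    countSol (c ∷ cs) (s * P) ∎
    where
    open ≤-Reasoning
    s′ = s % A
    z′ = s / A
    enough : q * 2 ^ l + s′ * x ≤ z′ * P
    enough = begin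
      q * 2 ^ l + s′ * x             ≤⟨ +-mono-≤ (*-monoˡ-≤ (2 ^ l) (n≤1+n q))
                                          (≤-trans (*-monoˡ-≤ x (<⇒≤ (m%n<n s A))) (m≤m+n _ (q * (A * x)))) ⟩
      suc q * 2 ^ l + suc q * (A * x) ≡⟨ *-distribˡ-+ (suc q) (2 ^ l) (A * x) ⟨
      suc q * R                      ≡⟨ m*n/n≡m (suc q * R) A ⟨
      suc q * R * A / A              ≤⟨ /-monoˡ-≤ A (≤-trans (≤-reflexive (*-assoc (suc q) R A)) qK≤s) ⟩
      z′                             ≤⟨ m≤m*n z′ P ⟩
      z′ * P ∎
    rearrange : ∀ s P x A y → s * (P + x * A) + y * A ≡ s * P + (y + s * x) * A
    rearrange = solve-∀
    collect : ∀ s z P A → s * P + z * P * A ≡ (s + z * A) * P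
    collect = solve-∀
    split : s′ * (P + x * A) + (z′ * P ∸ s′ * x) * A ≡ s * P
    split = begin-equality
      s′ * (P + x * A) + (z′ * P ∸ s′ * x) * A   ≡⟨ rearrange s′ P x A (z′ * P ∸ s′ * x) ⟩
      s′ * P + (z′ * P ∸ s′ * x + s′ * x) * A    ≡⟨ cong (λ y → s′ * P + y * A)
                                                   (m∸n+n≡m (≤-trans (m≤n+m (s′ * x) (q * 2 ^ l)) enough)) ⟩
      s′ * P + z′ * P * A                        ≡⟨ collect s′ z′ P A ⟩
      (s′ + z′ * A) * P                          ≡⟨ cong (_* P) (m≡m%n+[m/n]*n s A) ⟨
      s * P ∎

-- Strict increase along multiples of p

outgrows : ∀ {N E p K} → 0 < p → 0 < K → Small N E → (h : ℕ → ℕ) →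
  (∀ q s → suc q * K ≤ s → q ^ N ≤ h s) →
  Σ ℕ λ S → ∀ s → S ≤ s → ∣ E (s * p) ∣ < h s
outgrows {N} {E} {p} {K} p>0 K>0 (small C T bound) h grow = S , beats
  where
  instance
    K≢0 : NonZero K
    K≢0 = >-nonZero K>0
    p≢0 : NonZero p
    p≢0 = >-nonZero p>0
  -- With q = s / K - 1 ≥ 1 one has s + 1 ≤ (q + 2) K ≤ 3 K q, so t + 1 ≤ R q for t = s p. In `S`
  -- the summand 2 K ensures q ≥ 1, T is the onset of the bound, and C R^N rules out t + 1 ≤ C R^N.
  R = 3 * K * p
  S = 2 * K + T + C * R ^ N
  beats : ∀ s → S ≤ s → ∣ E (s * p) ∣ < h s
  beats s S≤s with ∣ E (s * p) ∣ <? h s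
  ... | yes E<h = E<h
  ... | no  E≮h = ⊥-elim (<-irrefl refl contra)
    where
    open ≤-Reasoning
    t = s * p
    q = pred (s / K)
    s≤t : s ≤ t
    s≤t = m≤m*n s p
    2≤s/K : 2 ≤ s / K
    2≤s/K = ≤-trans (≤-reflexive (sym (m*n/n≡m 2 K)))
      (/-monoˡ-≤ K (≤-trans (≤-trans (m≤m+n (2 * K) T) (m≤m+n _ _)) S≤s))
    suc-q : suc q ≡ s / K
    suc-q = suc-pred (s / K) ⦃ >-nonZero (≤-trans (s≤s z≤n) 2≤s/K) ⦄
    q≥1 : 1 ≤ q
    q≥1 = ≤-pred (≤-trans 2≤s/K (≤-reflexive (sym suc-q)))
    instance
      q≢0 : NonZero q
      q≢0 = >-nonZero q≥1
    qK≤s : suc q * K ≤ s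
    qK≤s = begin
      suc q * K         ≡⟨ cong (_* K) suc-q ⟩
      s / K * K         ≤⟨ m≤n+m _ (s % K) ⟩
      s % K + s / K * K ≡⟨ m≡m%n+[m/n]*n s K ⟨
      s ∎
    suc-t≤ : suc t ≤ R * q
    suc-t≤ = begin
      suc t                    ≤⟨ +-monoˡ-≤ t p>0 ⟩
      suc s * p                ≤⟨ *-monoˡ-≤ p (begin
        suc s                    ≡⟨ cong suc (m≡m%n+[m/n]*n s K) ⟩
        suc (s % K) + s / K * K  ≤⟨ +-monoˡ-≤ _ (m%n<n s K) ⟩
        K + s / K * K            ≡⟨ cong (λ y → K + y * K) (sym suc-q) ⟩
        K + suc q * K            ≤⟨ +-monoˡ-≤ _ (m≤m*n K q) ⟩
        K * q + (K + q * K)      ≤⟨ +-monoʳ-≤ (K * q) (+-monoˡ-≤ (q * K) (m≤m*n K q)) ⟩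
        K * q + (K * q + q * K)  ≡⟨ triple K q ⟩
        3 * K * q ∎) ⟩
      3 * K * q * p            ≡⟨ swap (3 * K) q p ⟩
      R * q ∎
      where
      triple : ∀ K q → K * q + (K * q + q * K) ≡ 3 * K * q
      triple = solve-∀
      swap : ∀ x y z → x * y * z ≡ x * z * y
      swap = solve-∀
    product-bound : suc t * q ^ N ≤ C * R ^ N * q ^ N
    product-bound = begin
      suc t * q ^ N         ≤⟨ *-monoʳ-≤ (suc t) (≤-trans (grow q s qK≤s) (≮⇒≥ E≮h)) ⟩
      suc t * ∣ E t ∣       ≤⟨ bound t (≤-trans (≤-trans (m≤n+m T (2 * K)) (m≤m+n _ _)) (≤-trans S≤s s≤t)) ⟩
      C * suc t ^ N         ≤⟨ *-monoʳ-≤ C (^-monoˡ-≤ N suc-t≤) ⟩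
      C * (R * q) ^ N       ≡⟨ cong (C *_) (^-*-distrib R q N) ⟩
      C * (R ^ N * q ^ N)   ≡⟨ *-assoc C _ _ ⟨
      C * R ^ N * q ^ N ∎
    contra : s < s
    contra = begin-strict
      s           ≤⟨ s≤t ⟩
      t           <⟨ n<1+n t ⟩
      suc t       ≤⟨ *-cancelʳ-≤ (suc t) (C * R ^ N) (q ^ N) ⦃ m^n≢0 q N ⦄ product-bound ⟩
      C * R ^ N   ≤⟨ m≤n+m _ _ ⟩
      S           ≤⟨ S≤s ⟩
      s ∎

-- If y ≤ 0, then x - k y ≥ x ≥ h, against the bound on its absolute value.
dominated⇒positive : ∀ (x y : ℤ) (h : ℕ) k → x ℤ.≥ + h → ∣ x ℤ.- + k ℤ.* y ∣ < h → + 0 ℤ.< y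
dominated⇒positive x y h k x≥h E<h with + 0 ℤ.<? y
... | yes 0<y = 0<y
... | no  0≮y = ⊥-elim (<-irrefl refl (<-≤-trans E<h (ℤ.drop‿+≤+ (ℤ.≤-trans x≥h x≤E))))
  where
  y≤0 : y ℤ.≤ + 0
  y≤0 = ℤ.≮⇒≥ 0≮y
  ky≤0 : + k ℤ.* y ℤ.≤ + 0
  ky≤0 = subst (+ k ℤ.* y ℤ.≤_) (ℤ.*-zeroʳ (+ k)) (ℤ.*-monoˡ-≤-nonNeg (+ k) y≤0)
  x≤E : x ℤ.≤ + ∣ x ℤ.- + k ℤ.* y ∣
  x≤E = ℤ.≤-trans (subst (ℤ._≤ x ℤ.- + k ℤ.* y) (ℤ.+-identityʳ x)
          (ℤ.+-monoʳ-≤ x (ℤ.neg-mono-≤ ky≤0))) (i≤∣i∣ (x ℤ.- + k ℤ.* y))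
    where
    i≤∣i∣ : ∀ i → i ℤ.≤ + ∣ i ∣
    i≤∣i∣ (+ n)      = ℤ.≤-refl
    i≤∣i∣ ℤ.-[1+ n ] = ℤ.-≤+

countSol-increasing : ∀ {p} → 0 < p → ∀ c c′ cs → (let as = c ∷ c′ ∷ cs) → Positive as →
  gcdList as ≡ 1 → (∀ {x cs′} → Rem x as cs′ → gcdList cs′ ∣ p) →
  Σ ℕ λ S → ∀ s → S ≤ s → countSol as (s * p) < countSol as (suc s * p)
countSol-increasing {p} p>0 c c′ cs pos@(c>0 ∷ pos′) gcd≡1 gcd∣p =
  proj₁ large , λ s S≤s → ℤ.drop‿+<+ (increase s (dominated⇒positive
    (diff (c * p) F (s * p)) (diff p F (s * p)) (h s) c (jump s) (proj₂ large s S≤s)))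
  where
  as = c ∷ c′ ∷ cs
  F  = +countSol as
  growth = countSol-growth p>0 c′ cs pos′ (gcd∣p here)
  h : ℕ → ℕ
  h s = countSol (c′ ∷ cs) ((c + s) * p)
  large : Σ ℕ λ S → ∀ s → S ≤ s → ∣ diff (c * p) F (s * p) ℤ.- + c ℤ.* diff p F (s * p) ∣ < h s
  large = outgrows p>0 (proj₁ (proj₂ growth)) (diff-multiple pos refl gcd≡1 gcd∣p c) h
    (λ q s qK≤s → proj₂ (proj₂ growth) q (c + s) (≤-trans qK≤s (m≤n+m s c)))
  jump : ∀ s → diff (c * p) F (s * p) ℤ.≥ + h s
  jump s = subst (+ h s ℤ.≤_) (cancel (+ countSol as (s * p)) (F (c * p + s * p)))
    (ℤ.≤-trans (ℤ.≤-reflexive (sym (cancel′ (+ countSol as (s * p)) (+ h s))))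
      (ℤ.+-monoʳ-≤ (ℤ.- (+ countSol as (s * p))) (ℤ.+≤+ step)))
    where
    cancel : ∀ x y → ℤ.- x ℤ.+ y ≡ y ℤ.- x
    cancel = ℤSolver.solve-∀
    cancel′ : ∀ x y → ℤ.- x ℤ.+ (x ℤ.+ y) ≡ y
    cancel′ = ℤSolver.solve-∀
    -- The length c p, which `diff-multiple` reads as c steps of length p, is read here as p steps
    -- of length c; the last of them contributes `h s`.
    step : countSol as (s * p) + h s ≤ countSol as (c * p + s * p)
    step = subst (λ u → countSol as (s * p) + countSol (c′ ∷ cs) u ≤ countSol as (c * p + s * p))
      (sym (*-distribʳ-+ p c s))
      (subst (λ u → countSol as (s * p) + countSol (c′ ∷ cs) (u + s * p) ≤ countSol as (u + s * p))
        (*-comm p c) (countSol-multiple pos here p p>0 (s * p)))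
  increase : ∀ s → + 0 ℤ.< diff p F (s * p) → F (s * p) ℤ.< F (suc s * p)
  increase s 0<d = subst₂ ℤ._<_ (ℤ.+-identityʳ _) (cancel (F (s * p)) (F (suc s * p)))
    (ℤ.+-monoʳ-< (F (s * p)) 0<d)
    where
    cancel : ∀ x y → x ℤ.+ (y ℤ.- x) ≡ y
    cancel = ℤSolver.solve-∀

-- Finite sums and products over lists and indices

ΣL : (ℕ → ℕ) → List ℕ → ℕ
ΣL τ l = sum (map τ l)

ΣL-cong-∈ : ∀ {τ υ} l → (∀ {x} → x ∈ l → τ x ≡ υ x) → ΣL τ l ≡ ΣL υ l
ΣL-cong-∈ []      eq = refl
ΣL-cong-∈ (x ∷ l) eq = cong₂ _+_ (eq (here refl)) (ΣL-cong-∈ l (eq ∘ there))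

ΣL-cong : ∀ {τ υ} l → (∀ x → τ x ≡ υ x) → ΣL τ l ≡ ΣL υ l
ΣL-cong l eq = ΣL-cong-∈ l (λ {x} _ → eq x)

ΣL-map : ∀ τ g l → ΣL τ (map g l) ≡ ΣL (τ ∘ g) l
ΣL-map τ g []      = refl
ΣL-map τ g (x ∷ l) = cong (λ z → τ (g x) + z) (ΣL-map τ g l)

ΣL-concatMap : ∀ τ g l → ΣL τ (concatMap g l) ≡ ΣL (ΣL τ ∘ g) l
ΣL-concatMap τ g []      = refl
ΣL-concatMap τ g (x ∷ l) = trans (cong sum (map-++ τ (g x) (concatMap g l)))
  (trans (sum-++ (map τ (g x)) _) (cong (λ z → ΣL τ (g x) + z) (ΣL-concatMap τ g l)))

ΣL-affine : ∀ c d l → ΣL (λ x → x * d + c) l ≡ ΣL (λ x → x) l * d + ΣL (λ _ → 1) l * c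
ΣL-affine c d []      = refl
ΣL-affine c d (x ∷ l) = trans (cong (λ z → x * d + c + z) (ΣL-affine c d l)) (eq x d c (ΣL (λ x → x) l) (ΣL (λ _ → 1) l))
  where
  eq : ∀ x d c s n → x * d + c + (s * d + n * c) ≡ (x + s) * d + (1 + n) * c
  eq = solve-∀

ΣL-zero : ∀ {τ : ℕ → ℕ} l → (∀ {x} → x ∈ l → τ x ≡ 0) → ΣL τ l ≡ 0
ΣL-zero []      z = refl
ΣL-zero (x ∷ l) z = cong₂ _+_ (z (here refl)) (ΣL-zero l (z ∘ there))

ΣL-single : ∀ {τ : ℕ → ℕ} {l w} → Unique l → w ∈ l → (∀ {x} → x ∈ l → x ≢ w → τ x ≡ 0) → ΣL τ l ≡ τ w
ΣL-single {τ} {x ∷ l} (x∉l ∷ _) (here refl) z = trans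
  (cong (λ z → τ x + z) (ΣL-zero l (λ y∈l → z (there y∈l) (λ y≡x → All.lookup x∉l y∈l (sym y≡x)))))
  (+-identityʳ _)
ΣL-single {τ} {x ∷ l} (x∉l ∷ u) (there w∈l) z =
  cong₂ _+_ (z (here refl) (All.lookup x∉l w∈l)) (ΣL-single u w∈l (z ∘ there))

ΣFin-cong : ∀ {n} {g h : Fin n → ℕ} → (∀ i → g i ≡ h i) → ΣFin g ≡ ΣFin h
ΣFin-cong {zero}  eq = refl
ΣFin-cong {suc n} eq = cong₂ _+_ (eq zero) (ΣFin-cong (eq ∘ suc))

ΣFin-mono : ∀ {n} {g h : Fin n → ℕ} → (∀ i → g i ≤ h i) → ΣFin g ≤ ΣFin h
ΣFin-mono {zero}  le = z≤n
ΣFin-mono {suc n} le = +-mono-≤ (le zero) (ΣFin-mono (le ∘ suc))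

ΣFin-+ : ∀ {n} (g h : Fin n → ℕ) → ΣFin (λ i → g i + h i) ≡ ΣFin g + ΣFin h
ΣFin-+ {zero}  g h = refl
ΣFin-+ {suc n} g h = trans (cong (λ z → g zero + h zero + z) (ΣFin-+ (g ∘ suc) (h ∘ suc)))
  (interchange (g zero) (h zero) _ _)

ΣFin-* : ∀ {n} k (g : Fin n → ℕ) → ΣFin (λ i → k * g i) ≡ k * ΣFin g
ΣFin-* {zero}  k g = sym (*-zeroʳ k)
ΣFin-* {suc n} k g = trans (cong (λ z → k * g zero + z) (ΣFin-* k (g ∘ suc))) (sym (*-distribˡ-+ k (g zero) _))

∣-ΣFin : ∀ {n d} {g : Fin n → ℕ} → (∀ i → d ∣ g i) → d ∣ ΣFin g
∣-ΣFin {zero}  {d} _ = d ∣0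
∣-ΣFin {suc n} d∣g   = ∣m∣n⇒∣m+n (d∣g zero) (∣-ΣFin (d∣g ∘ suc))

ΠFin : ∀ {n} → (Fin n → ℕ) → ℕ
ΠFin h = V.foldr _ _*_ 1 (V.tabulate h)

∣ΠFin : ∀ {n} (h : Fin n → ℕ) i → h i ∣ ΠFin h
∣ΠFin h zero    = m∣m*n (ΠFin (h ∘ suc))
∣ΠFin h (suc i) = ∣n⇒∣m*n (h zero) (∣ΠFin (h ∘ suc) i)

ΠFin>0 : ∀ {n} {h : Fin n → ℕ} → (∀ i → 0 < h i) → 0 < ΠFin h
ΠFin>0 {zero}  _   = s≤s z≤n
ΠFin>0 {suc n} h>0 = *-mono-≤ (h>0 zero) (ΠFin>0 (h>0 ∘ suc))

Coprime-* : ∀ {d m n} → Coprime d m → Coprime d n → Coprime d (m * n)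
Coprime-* dm dn (k∣d , k∣mn) =
  dn (k∣d , coprime-divisor (λ (j∣k , j∣m) → dm (∣-trans j∣k k∣d , j∣m)) k∣mn)

Coprime-ΠFin : ∀ {n d} {h : Fin n → ℕ} → (∀ i → Coprime d (h i)) → Coprime d (ΠFin h)
Coprime-ΠFin {zero}  _ (_ , k∣1) = ∣1⇒≡1 k∣1
Coprime-ΠFin {suc n} c           = Coprime-* (c zero) (Coprime-ΠFin (c ∘ suc))

-- Digit sums: the offsets inside a block

val : ∀ {n} → (Fin n → ℕ) → (Fin n → ℕ) → ℕ
val A r = ΣFin (λ i → A i * r i)

val-0 : ∀ {n} (A : Fin n → ℕ) → val A (λ _ → 0) ≡ 0
val-0 {zero}  A = refl
val-0 {suc n} A = cong₂ _+_ (*-zeroʳ (A zero)) (val-0 (A ∘ suc))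

-- For a > 0 these are the exponents of the polynomial (1 - x^(da)) / (1 - x^a).
multiples : ℕ → ℕ → List ℕ
multiples a zero    = []
multiples a (suc d) = a * d ∷ multiples a d

∈-multiples⁻ : ∀ {a d m} → m ∈ multiples a d → Σ ℕ λ r → r < d × m ≡ a * r
∈-multiples⁻ {d = suc d} (here refl) = d , ≤-refl , refl
∈-multiples⁻ {d = suc d} (there m∈) with ∈-multiples⁻ m∈
... | r , r<d , eq = r , m<n⇒m<1+n r<d , eq

∈-multiples⁺ : ∀ a {d r} → r < d → a * r ∈ multiples a d
∈-multiples⁺ a {suc d} {r} r<d with r ≟ d
... | yes refl = here refl
... | no  r≢d  = there (∈-multiples⁺ a (≤∧≢⇒< (≤-pred r<d) r≢d))

multiples-unique : ∀ a d → 0 < a → Unique (multiples a d)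
multiples-unique a         zero    a>0 = []
multiples-unique a@(suc _) (suc d) a>0 =
  All.tabulate (λ m∈ eq → let (r , r<d , m≡ar) = ∈-multiples⁻ m∈ in
    <⇒≢ r<d (sym (*-cancelˡ-≡ d r a (trans eq m≡ar))))
  ∷ multiples-unique a d a>0

ΣL-multiples-1 : ∀ a d → ΣL (λ _ → 1) (multiples a d) ≡ d
ΣL-multiples-1 a zero    = refl
ΣL-multiples-1 a (suc d) = cong suc (ΣL-multiples-1 a d)

ΣL-multiples-id : ∀ a d → 2 * ΣL (λ m → m) (multiples a d) ≡ a * d * (d ∸ 1)
ΣL-multiples-id a zero          = sym (*-zeroʳ (a * 0))
ΣL-multiples-id a (suc zero)    = eq a
  where
  eq : ∀ a → 2 * (a * 0 + 0) ≡ a * 1 * 0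
  eq = solve-∀
ΣL-multiples-id a (suc (suc d)) = trans (eq a d _)
  (trans (cong (λ x → 2 * (a * suc d) + x) (ΣL-multiples-id a (suc d))) (eq′ a d))
  where
  eq : ∀ a d x → 2 * (a * suc d + x) ≡ 2 * (a * suc d) + 2 * x
  eq = solve-∀
  eq′ : ∀ a d → 2 * (a * suc d) + a * suc d * d ≡ a * suc (suc d) * suc d
  eq′ = solve-∀

ΣL-multiples-+ : ∀ a d w → ΣL (λ z → w + z) (multiples a d) ≡ w * d + ΣL (λ m → m) (multiples a d)
ΣL-multiples-+ a zero    w = sym (trans (+-identityʳ _) (*-zeroʳ w))
ΣL-multiples-+ a (suc d) w = trans (cong (λ z → w + a * d + z) (ΣL-multiples-+ a d w)) (eq w (a * d) d _)
  where
  eq : ∀ w x d y → w + x + (w * d + y) ≡ w * suc d + (x + y)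
  eq = solve-∀

-- The exponents, with multiplicity, of the product of the (1 - x^(D i A i)) / (1 - x^(A i)), and at
-- the same time the offsets of a block from its least element.
digitSums : ∀ {n} → (Fin n → ℕ) → (Fin n → ℕ) → List ℕ
digitSums {zero}  A D = 0 ∷ []
digitSums {suc n} A D =
  concatMap (λ w → map (λ z → w + z) (multiples (A zero) (D zero))) (digitSums (A ∘ suc) (D ∘ suc))

∈-translates⁻ : ∀ {v ms} l → v ∈ concatMap (λ w → map (λ z → w + z) ms) l →
                Σ ℕ λ w → Σ ℕ λ m → w ∈ l × m ∈ ms × v ≡ w + m
∈-translates⁻ l v∈ with find (∈-concatMap⁻ _ {xs = l} v∈)
... | w , w∈l , v∈w+ms with ∈-map⁻ (λ z → w + z) v∈w+ms
... | m , m∈ms , eq = w , m , w∈l , m∈ms , eq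

∈-translates⁺ : ∀ {w m ms l} → w ∈ l → m ∈ ms → w + m ∈ concatMap (λ w → map (λ z → w + z) ms) l
∈-translates⁺ {w} w∈l m∈ms = ∈-concatMap⁺ _ (lose w∈l (∈-map⁺ (λ z → w + z) m∈ms))

translates-unique : ∀ {l ms} → Unique l → Unique ms →
  (∀ {w w′ m m′} → w ∈ l → w′ ∈ l → m ∈ ms → m′ ∈ ms → w + m ≡ w′ + m′ → w ≡ w′) →
  Unique (concatMap (λ w → map (λ z → w + z) ms) l)
translates-unique {[]}    []          u-ms inj = []
translates-unique {w ∷ l} (w∉l ∷ u-l) u-ms inj = ++⁺
  (map⁺ (λ {x} {y} → +-cancelˡ-≡ w x y) u-ms)
  (translates-unique u-l u-ms (λ w∈ w′∈ → inj (there w∈) (there w′∈)))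
  λ (v∈₁ , v∈₂) → let (m , m∈ , eq)                = ∈-map⁻ (λ z → w + z) v∈₁
                      (w′ , m′ , w′∈ , m′∈ , eq′) = ∈-translates⁻ l v∈₂
                  in All.lookup w∉l w′∈ (inj (here refl) (there w′∈) m∈ m′∈ (trans (sym eq) eq′))

∈-digitSums⁻ : ∀ {n} (A D : Fin n → ℕ) {w} → w ∈ digitSums A D →
               Σ (Fin n → ℕ) λ r → (∀ i → r i < D i) × w ≡ val A r
∈-digitSums⁻ {zero}  A D (here refl) = (λ ()) , (λ ()) , refl
∈-digitSums⁻ {suc n} A D w∈ with ∈-translates⁻ (digitSums (A ∘ suc) (D ∘ suc)) w∈
... | w′ , m , w′∈ , m∈ , refl with ∈-digitSums⁻ (A ∘ suc) (D ∘ suc) w′∈ | ∈-multiples⁻ m∈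
... | r , r<D , refl | r₀ , r₀<d , refl =
  (λ { zero → r₀ ; (suc i) → r i }) , (λ { zero → r₀<d ; (suc i) → r<D i }) ,
  +-comm (val (A ∘ suc) r) (A zero * r₀)

∈-digitSums⁺ : ∀ {n} (A D r : Fin n → ℕ) → (∀ i → r i < D i) → val A r ∈ digitSums A D
∈-digitSums⁺ {zero}  A D r r<D = here refl
∈-digitSums⁺ {suc n} A D r r<D = subst (_∈ digitSums A D)
  (+-comm (val (A ∘ suc) (r ∘ suc)) (A zero * r zero))
  (∈-translates⁺ (∈-digitSums⁺ (A ∘ suc) (D ∘ suc) (r ∘ suc) (r<D ∘ suc))
                 (∈-multiples⁺ (A zero) (r<D zero)))

ΣL-digitSums : ∀ {n} τ (A D : Fin (suc n) → ℕ) →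
  ΣL τ (digitSums A D) ≡
  ΣL (λ w → ΣL (λ m → τ (w + m)) (multiples (A zero) (D zero))) (digitSums (A ∘ suc) (D ∘ suc))
ΣL-digitSums τ A D = trans (ΣL-concatMap τ _ W′)
  (ΣL-cong W′ (λ w → ΣL-map τ (λ z → w + z) (multiples (A zero) (D zero))))
  where W′ = digitSums (A ∘ suc) (D ∘ suc)

digitSums-count : ∀ {n} (A D : Fin n → ℕ) → ΣL (λ _ → 1) (digitSums A D) ≡ ΠFin D
digitSums-count {zero}  A D = refl
digitSums-count {suc n} A D = begin
  ΣL (λ _ → 1) (digitSums A D)  ≡⟨ ΣL-digitSums (λ _ → 1) A D ⟩
  ΣL (λ _ → ΣL (λ _ → 1) (multiples (A zero) (D zero))) W′
                                ≡⟨ ΣL-cong W′ (λ w → trans (ΣL-multiples-1 (A zero) (D zero))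
                                     (cong (_+ D zero) (sym (*-zeroʳ w)))) ⟩
  ΣL (λ w → w * 0 + D zero) W′  ≡⟨ ΣL-affine (D zero) 0 W′ ⟩
  ΣL (λ w → w) W′ * 0 + ΣL (λ _ → 1) W′ * D zero
                                ≡⟨ cong₂ _+_ (*-zeroʳ (ΣL (λ w → w) W′)) (cong (_* D zero) (digitSums-count (A ∘ suc) (D ∘ suc))) ⟩
  ΠFin (D ∘ suc) * D zero       ≡⟨ *-comm (ΠFin (D ∘ suc)) (D zero) ⟩
  ΠFin D ∎
  where
  open ≡-Reasoning
  W′ = digitSums (A ∘ suc) (D ∘ suc)

-- On average over the list the i-th digit is (D i - 1) / 2; doubling keeps the identity in ℕ.
digitSums-sum : ∀ {n} (A D : Fin n → ℕ) →
                2 * ΣL (λ w → w) (digitSums A D) ≡ ΣFin (λ i → ΠFin D * A i * (D i ∸ 1))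
digitSums-sum {zero}  A D = refl
digitSums-sum {suc n} A D = begin
  2 * ΣL (λ w → w) (digitSums A D)
    ≡⟨ cong (2 *_) (trans (ΣL-digitSums (λ w → w) A D)
         (trans (ΣL-cong W′ (ΣL-multiples-+ a d)) (ΣL-affine c d W′))) ⟩
  2 * (S′ * d + ΣL (λ _ → 1) W′ * c)
    ≡⟨ cong (λ z → 2 * (S′ * d + z * c)) (digitSums-count (A ∘ suc) (D ∘ suc)) ⟩
  2 * (S′ * d + P′ * c)
    ≡⟨ eq S′ d P′ c ⟩
  P′ * (2 * c) + d * (2 * S′)
    ≡⟨ cong₂ (λ y z → P′ * y + d * z) (ΣL-multiples-id a d) (digitSums-sum (A ∘ suc) (D ∘ suc)) ⟩
  P′ * (a * d * (d ∸ 1)) + d * ΣFin (λ i → P′ * A (suc i) * (D (suc i) ∸ 1))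
    ≡⟨ cong₂ _+_ (eq′ P′ a d (d ∸ 1))
         (trans (sym (ΣFin-* d (λ i → P′ * A (suc i) * (D (suc i) ∸ 1)))) (ΣFin-cong (λ i → eq″ d P′ (A (suc i)) (D (suc i) ∸ 1)))) ⟩
  ΣFin (λ i → ΠFin D * A i * (D i ∸ 1)) ∎
  where
  open ≡-Reasoning
  a  = A zero
  d  = D zero
  W′ = digitSums (A ∘ suc) (D ∘ suc)
  P′ = ΠFin (D ∘ suc)
  S′ = ΣL (λ w → w) W′
  c  = ΣL (λ m → m) (multiples a d)
  eq : ∀ s d p c → 2 * (s * d + p * c) ≡ p * (2 * c) + d * (2 * s)
  eq = solve-∀
  eq′ : ∀ p a d e → p * (a * d * e) ≡ d * p * a * e
  eq′ = solve-∀
  eq″ : ∀ d p a e → d * (p * a * e) ≡ d * p * a * e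
  eq″ = solve-∀

-- Uniqueness of digits and constancy on blocks

record System {n} (A D : Fin n → ℕ) : Set where
  field
    A>0     : ∀ i → 0 < A i
    D>0     : ∀ i → 0 < D i
    coprime : ∀ i → Coprime (D i) (A i)
    D∣A     : ∀ {i j} → i ≢ j → D i ∣ A j

  ΠD = ΠFin D

  maxSum : ℕ
  maxSum = ΣFin (λ i → (D i ∸ 1) * A i)

  val≤maxSum : ∀ {r} → (∀ i → r i < D i) → val A r ≤ maxSum
  val≤maxSum r<D = ΣFin-mono (λ i → ≤-trans (*-monoʳ-≤ (A i) (m<n⇒m≤n∸1 (r<D i)))
                                            (≤-reflexive (*-comm (A i) _)))
    where
    m<n⇒m≤n∸1 : ∀ {m n} → m < n → m ≤ n ∸ 1
    m<n⇒m≤n∸1 (s≤s m≤n) = m≤n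

  ∈⇒≤maxSum : ∀ {w} → w ∈ digitSums A D → w ≤ maxSum
  ∈⇒≤maxSum w∈ with ∈-digitSums⁻ A D w∈
  ... | r , r<D , refl = val≤maxSum r<D

  maxSum∈ : maxSum ∈ digitSums A D
  maxSum∈ = subst (_∈ digitSums A D) (ΣFin-cong (λ i → *-comm (A i) (D i ∸ 1)))
    (∈-digitSums⁺ A D (λ i → D i ∸ 1) (λ i → ∸1< (D>0 i)))
    where
    ∸1< : ∀ {n} → 0 < n → n ∸ 1 < n
    ∸1< (s≤s _) = ≤-refl

  0∈ : 0 ∈ digitSums A D
  0∈ = subst (_∈ digitSums A D) (val-0 A) (∈-digitSums⁺ A D (λ _ → 0) D>0)

-- The inductions on the index set rest on this. The four conditions survive the loss of the first
-- index, whereas the gcd conditions on the vector do not: the remaining entries may have a common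
-- factor, and their own `dd` may differ.
tail : ∀ {n} {A D : Fin (suc n) → ℕ} → System A D → System (A ∘ suc) (D ∘ suc)
tail sys = record
  { A>0     = A>0 ∘ suc
  ; D>0     = D>0 ∘ suc
  ; coprime = coprime ∘ suc
  ; D∣A     = λ i≢j → D∣A (λ { refl → i≢j refl })
  }
  where open System sys

head∣val-tail : ∀ {n} {A D : Fin (suc n) → ℕ} → System A D → ∀ r → D zero ∣ val (A ∘ suc) r
head∣val-tail sys r = ∣-ΣFin (λ i → ∣m⇒∣m*n (r i) (System.D∣A sys {zero} {suc i} λ ()))

-- Modulo d both x and y vanish, so d divides a (r′ - r), hence r′ - r, which is smaller than d.
digit-unique-≤ : ∀ {d a x y r r′} → Coprime d a → d ∣ x → d ∣ y → r′ < d → r ≤ r′ →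
                 x + a * r ≡ y + a * r′ → r ≡ r′
digit-unique-≤ {d} {a} {x} {y} {r} {r′} cop d∣x d∣y r′<d r≤r′ eq with r′ ∸ r in r′∸r
... | zero  = ≤-antisym r≤r′ (m∸n≡0⇒m≤n r′∸r)
... | suc k = ⊥-elim (<⇒≱ (≤-<-trans (≤-trans (≤-reflexive (sym r′∸r)) (m∸n≤m r′ r)) r′<d) (∣⇒≤ d∣k))
  where
  r′≡ : r + suc k ≡ r′
  r′≡ = trans (cong (λ z → r + z) (sym r′∸r)) (m+[n∸m]≡n r≤r′)
  x≡ : x ≡ y + a * suc k
  x≡ = +-cancelʳ-≡ (a * r) x (y + a * suc k) (trans eq (trans (cong (λ z → y + a * z) (sym r′≡)) (alg y a r (suc k))))
    where
    alg : ∀ y a r k → y + a * (r + k) ≡ y + a * k + a * r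
    alg = solve-∀
  d∣k : d ∣ suc k
  d∣k = coprime-divisor cop (∣m+n∣m⇒∣n (subst (d ∣_) x≡ d∣x) d∣y)

digit-unique : ∀ {d a x y r r′} → Coprime d a → d ∣ x → d ∣ y → r < d → r′ < d →
               x + a * r ≡ y + a * r′ → r ≡ r′
digit-unique {r = r} {r′} cop d∣x d∣y r<d r′<d eq with ≤-total r r′
... | inj₁ r≤r′ = digit-unique-≤ cop d∣x d∣y r′<d r≤r′ eq
... | inj₂ r′≤r = sym (digit-unique-≤ cop d∣y d∣x r<d r′≤r (sym eq))

-- Modulo `D zero` all later summands vanish, which isolates the first digit; it is cancelled and
-- the tail remains. Arbitrary common multiples x and y allow for two different blocks u p and u′ p.
val-unique : ∀ {n} {A D : Fin n → ℕ} → System A D → ∀ {x y r r′} →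
  (∀ i → D i ∣ x) → (∀ i → D i ∣ y) → (∀ i → r i < D i) → (∀ i → r′ i < D i) →
  x + val A r ≡ y + val A r′ → val A r ≡ val A r′
val-unique {zero}  sys D∣x D∣y r<D r′<D eq = refl
val-unique {suc n} {A} {D} sys {x} {y} {r} {r′} D∣x D∣y r<D r′<D eq =
  cong₂ (λ z v → A zero * z + v) r₀≡ (val-unique (tail sys) (D∣x ∘ suc) (D∣y ∘ suc) (r<D ∘ suc) (r′<D ∘ suc)
    (+-cancelʳ-≡ (A zero * r zero) (x + v) (y + v′) (trans eq′ (cong (λ z → y + v′ + A zero * z) (sym r₀≡)))))
  where
  v  = val (A ∘ suc) (r ∘ suc)
  v′ = val (A ∘ suc) (r′ ∘ suc)
  alg : ∀ x m v → x + (m + v) ≡ x + v + m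
  alg = solve-∀
  eq′ : x + v + A zero * r zero ≡ y + v′ + A zero * r′ zero
  eq′ = trans (sym (alg x (A zero * r zero) v)) (trans eq (alg y (A zero * r′ zero) v′))
  r₀≡ : r zero ≡ r′ zero
  r₀≡ = digit-unique (System.coprime sys zero)
    (∣m∣n⇒∣m+n (D∣x zero) (head∣val-tail sys (r ∘ suc)))
    (∣m∣n⇒∣m+n (D∣y zero) (head∣val-tail sys (r′ ∘ suc))) (r<D zero) (r′<D zero) eq′

digitSums-unique : ∀ {n} {A D : Fin n → ℕ} → System A D → Unique (digitSums A D)
digitSums-unique {zero}  sys = [] ∷ []
digitSums-unique {suc n} {A} {D} sys = translates-unique (digitSums-unique (tail sys))
  (multiples-unique (A zero) (D zero) (System.A>0 sys zero)) separate
  where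
  separate : ∀ {w w′ m m′} → w ∈ digitSums (A ∘ suc) (D ∘ suc) → w′ ∈ digitSums (A ∘ suc) (D ∘ suc) →
             m ∈ multiples (A zero) (D zero) → m′ ∈ multiples (A zero) (D zero) →
             w + m ≡ w′ + m′ → w ≡ w′
  separate w∈ w′∈ m∈ m′∈ eq
    with ∈-digitSums⁻ (A ∘ suc) (D ∘ suc) w∈ | ∈-digitSums⁻ (A ∘ suc) (D ∘ suc) w′∈ | ∈-multiples⁻ m∈ | ∈-multiples⁻ m′∈
  ... | r , _ , refl | r′ , _ , refl | k , k<d , refl | k′ , k′<d , refl
    with digit-unique (System.coprime sys zero) (head∣val-tail sys r) (head∣val-tail sys r′) k<d k′<d eq
  ... | refl = +-cancelʳ-≡ (A zero * k) _ _ eq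

-- The digits are raised one index at a time. While the first digit moves, the rest v + t stays
-- divisible by `D zero`; by coprimality no `A zero * k + (v + t)` with 0 < k < D zero is, so the
-- exception in the hypothesis on steps is never met.
val-invariant : ∀ {n} {A D : Fin n → ℕ} → System A D → (F : ℕ → ℕ) →
  (∀ i t → ¬ D i ∣ A i + t → F (A i + t) ≡ F t) →
  ∀ {r t} → (∀ i → r i < D i) → (∀ i → D i ∣ t) → F (val A r + t) ≡ F t
val-invariant {zero}  sys F step r<D D∣t = refl
val-invariant {suc n} {A} {D} sys F step {r} {t} r<D D∣t = trans
  (trans (cong F (+-assoc (A zero * r zero) v t)) (climb (r zero) (r<D zero)))
  (val-invariant (tail sys) F (step ∘ suc) (r<D ∘ suc) (D∣t ∘ suc))
  where
  v = val (A ∘ suc) (r ∘ suc)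
  d∣v+t : D zero ∣ v + t
  d∣v+t = ∣m∣n⇒∣m+n (head∣val-tail sys (r ∘ suc)) (D∣t zero)
  climb : ∀ k → k < D zero → F (A zero * k + (v + t)) ≡ F (v + t)
  climb zero    _   = cong (λ z → F (z + (v + t))) (*-zeroʳ (A zero))
  climb (suc k) k<d = trans (cong F (trans (cong (_+ (v + t)) (*-suc (A zero) k)) (+-assoc (A zero) _ _)))
    (trans (step zero (A zero * k + (v + t)) d∤) (climb k (<-trans (n<1+n k) k<d)))
    where
    d∤ : ¬ D zero ∣ A zero + (A zero * k + (v + t))
    d∤ d∣ = <⇒≱ k<d (∣⇒≤ (coprime-divisor (System.coprime sys zero)
      (∣m+n∣n⇒∣m (subst (D zero ∣_) (trans (sym (+-assoc (A zero) _ _)) (cong (_+ (v + t)) (sym (*-suc (A zero) k)))) d∣) d∣v+t)))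
      where
      ∣m+n∣n⇒∣m : ∀ {i m n} → i ∣ m + n → i ∣ n → i ∣ m
      ∣m+n∣n⇒∣m {i} {m} {n} i∣m+n = ∣m+n∣m⇒∣n (subst (i ∣_) (+-comm m n) i∣m+n)

-- Divisibility by the product, and covering by blocks

ΠFin∣ : ∀ {n} {A D : Fin n → ℕ} → System A D → ∀ {y} → (∀ i → D i ∣ y) → ΠFin D ∣ y
ΠFin∣ {zero}  sys D∣y = 1∣ _
ΠFin∣ {suc n} {A} {D} sys D∣y with ΠFin∣ (tail sys) (D∣y ∘ suc)
... | divides k refl = *-monoˡ-∣ (ΠFin (D ∘ suc)) (coprime-divisor
        (Coprime-ΠFin (λ i → coprime-D i))
        (subst (D zero ∣_) (*-comm k (ΠFin (D ∘ suc))) (D∣y zero)))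
  where
  -- `D zero` divides `A (suc i)`, which is coprime to `D (suc i)`.
  coprime-D : ∀ i → Coprime (D zero) (D (suc i))
  coprime-D i (j∣d , j∣Di) = System.coprime sys (suc i) (j∣Di , ∣-trans j∣d (System.D∣A sys {zero} {suc i} λ ()))

module _ {n} {A D : Fin n → ℕ} (sys : System A D) where
  open System sys

  -- Every other D j divides A i. Hence a carry of D i out of the i-th digit changes the value by a
  -- multiple of the product, which lets `val-reduce` bring all digits into range.
  ΠD∣AD : ∀ i → ΠD ∣ A i * D i
  ΠD∣AD i = ΠFin∣ sys divide
    where
    divide : ∀ j → D j ∣ A i * D i
    divide j with j Fin.≟ i
    ... | yes refl = ∣n⇒∣m*n (A i) ∣-refl
    ... | no  j≢i  = ∣m⇒∣m*n (D i) (D∣A j≢i)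

  val-reduce : ∀ r → Σ ℕ λ w → Σ ℕ λ k → w ∈ digitSums A D × val A r ≡ w + k * ΠD
  val-reduce r with ∣-ΣFin (λ i → ∣m⇒∣m*n (quot i) (ΠD∣AD i))
    where
    quot : Fin n → ℕ
    quot i = _/_ (r i) (D i) ⦃ >-nonZero (D>0 i) ⦄
  ... | divides k eq = val A rem , k , ∈-digitSums⁺ A D rem (λ i → m%n<n (r i) (D i) ⦃ >-nonZero (D>0 i) ⦄) ,
    trans (ΣFin-cong split) (trans (ΣFin-+ (λ i → A i * rem i) _) (cong (λ z → val A rem + z) eq))
    where
    rem : Fin n → ℕ
    rem i = _%_ (r i) (D i) ⦃ >-nonZero (D>0 i) ⦄
    alg : ∀ a x q d → a * (x + q * d) ≡ a * x + a * d * q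
    alg = solve-∀
    split : ∀ i → A i * r i ≡ A i * rem i + A i * D i * (_/_ (r i) (D i) ⦃ >-nonZero (D>0 i) ⦄)
    split i = trans (cong (A i *_) (m≡m%n+[m/n]*n (r i) (D i) ⦃ >-nonZero (D>0 i) ⦄)) (alg (A i) _ _ (D i))

span : ∀ {n} (A : Fin n → ℕ) → Submonoid (λ y → Σ (Fin n → ℕ) λ r → y ≡ val A r)
span A = record
  { zero∈ = (λ _ → 0) , sym (val-0 A)
  ; +∈    = λ { (r , refl) (r′ , refl) → (λ i → r i + r′ i) ,
      sym (trans (ΣFin-cong (λ i → *-distribˡ-+ (A i) (r i) (r′ i))) (ΣFin-+ (λ i → A i * r i) _)) }
  }

entry∈span : ∀ {n} (a : Vec ℕ n) {x cs} → Rem x (toList a) cs → Σ (Fin n → ℕ) λ r → x ≡ val (lookup a) r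
entry∈span (x ∷ a) here = (λ { zero → 1 ; (suc _) → 0 }) ,
  sym (trans (cong₂ _+_ (*-identityʳ x) (val-0 (lookup a))) (+-identityʳ x))
entry∈span (y ∷ a) (there rem) with entry∈span a rem
... | r , eq = (λ { zero → 0 ; (suc i) → r i }) , trans eq (cong (_+ val (lookup a) r) (sym (*-zeroʳ y)))

-- Since the entries have gcd 1, some t + x p is a nonnegative combination of them, and reducing its
-- digits gives w + k p. As w ≤ `maxSum` ≤ t, the difference k - x is not negative.
cover : ∀ {n} (a : Vec ℕ n) {D} (sys : System (lookup a) D) → gcdList (toList a) ≡ 1 →
  ∀ t → System.maxSum sys ≤ t →
  Σ ℕ λ u → Σ ℕ λ w → w ∈ digitSums (lookup a) D × t ≡ u * ΠFin D + w
cover a {D} sys gcd≡1 t max≤t with Mod.∣∈ (1∣ t) one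
  where
  module Mod = Subgroup (mod-subgroup (ΠFin D) (ΠFin>0 (System.D>0 sys)) (span (lookup a)))
  one : Σ ℕ λ x → Σ (Fin _ → ℕ) λ r → 1 + x * ΠFin D ≡ val (lookup a) r
  one = subst (λ y → Σ ℕ λ x → Σ (Fin _ → ℕ) λ r → y + x * ΠFin D ≡ val (lookup a) r) gcd≡1
    (Mod.gcdList∈ (λ {x} r → 0 , proj₁ (entry∈span a r) , trans (+-identityʳ x) (proj₂ (entry∈span a r))))
... | x , r , eq with val-reduce sys r
... | w , k , w∈ , eq′ = k ∸ x , w , w∈ , +-cancelʳ-≡ (x * p) t ((k ∸ x) * p + w) (begin
  t + x * p                 ≡⟨ eq″ ⟩
  w + k * p                 ≡⟨ cong (λ z → w + z * p) (m∸n+n≡m x≤k) ⟨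
  w + (k ∸ x + x) * p       ≡⟨ alg w (k ∸ x) x p ⟩
  (k ∸ x) * p + w + x * p   ∎)
  where
  open ≡-Reasoning
  p = ΠFin D
  eq″ : t + x * p ≡ w + k * p
  eq″ = trans eq eq′
  x≤k : x ≤ k
  x≤k = *-cancelʳ-≤ x k p ⦃ >-nonZero (ΠFin>0 (System.D>0 sys)) ⦄
    (+-cancelˡ-≤ w (x * p) (k * p) (≤-trans
      (+-monoˡ-≤ (x * p) (≤-trans (System.∈⇒≤maxSum sys w∈) max≤t)) (≤-reflexive eq″)))
  alg : ∀ w y x p → w + (y + x) * p ≡ y * p + w + x * p
  alg = solve-∀

-- Power series with natural coefficients

δ : ℕ → ℕ → ℕ
δ m t = if t ≡ᵇ m then 1 else 0

δ-refl : ∀ m → δ m m ≡ 1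
δ-refl zero    = refl
δ-refl (suc m) = δ-refl m

δ-≢ : ∀ {m t} → t ≢ m → δ m t ≡ 0
δ-≢ {zero}  {zero}  t≢m = ⊥-elim (t≢m refl)
δ-≢ {zero}  {suc t} t≢m = refl
δ-≢ {suc m} {zero}  t≢m = refl
δ-≢ {suc m} {suc t} t≢m = δ-≢ {m} {t} (t≢m ∘ cong suc)

sh-δ : ∀ k m t → sh k (δ m) t ≡ δ (k + m) t
sh-δ zero    m t       = refl
sh-δ (suc k) m zero    = refl
sh-δ (suc k) m (suc t) = sh-δ k m t

occ : List ℕ → ℕ → ℕ
occ l t = ΣL (λ w → δ w t) l

sh-occ : ∀ k l t → sh k (occ l) t ≡ ΣL (λ m → δ (k + m) t) l
sh-occ k []      t = sh-zero k t
sh-occ k (x ∷ l) t = trans (sh-+ k (δ x) (occ l) t) (cong₂ _+_ (sh-δ k x t) (sh-occ k l t))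

-- The series 1/(1 - x^m) over ℕ: products are computed there and only then cast to ℤ.
geom : ℕ → ℕ → ℕ
geom m t = if ⌊ m ∣? t ⌋ then 1 else 0

geom-∣ : ∀ {m t} → m ∣ t → geom m t ≡ 1
geom-∣ {m} {t} m∣t with m ∣? t
... | yes _   = refl
... | no  m∤t = ⊥-elim (m∤t m∣t)

geom-∤ : ∀ {m t} → ¬ m ∣ t → geom m t ≡ 0
geom-∤ {m} {t} m∤t with m ∣? t
... | yes m∣t = ⊥-elim (m∤t m∣t)
... | no  _   = refl

geom-rec : ∀ a t → 0 < a → geom a t ≡ δ 0 t + sh a (geom a) t
geom-rec a@(suc _) zero    _ = geom-∣ (a ∣0)
geom-rec a@(suc _) t@(suc _) _ with a ≤? t
... | no  a≰t = trans (geom-∤ (λ a∣t → a≰t (∣⇒≤ a∣t))) (sym (sh-> (geom a) (≰⇒> a≰t)))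
... | yes a≤t = trans (cong (geom a) (sym (m+[n∸m]≡n a≤t)))
    (trans (periodic (t ∸ a)) (trans (sym (sh-at a (geom a) (t ∸ a)))
      (cong (sh a (geom a)) (m+[n∸m]≡n a≤t))))
  where
  periodic : ∀ t → geom a (a + t) ≡ geom a t
  periodic t with a ∣? t
  ... | yes a∣t = geom-∣ (∣m∣n⇒∣m+n ∣-refl a∣t)
  ... | no  a∤t = geom-∤ (λ a∣a+t → a∤t (∣m+n∣m⇒∣n a∣a+t ∣-refl))

-- The finite geometric sum with its subtraction moved to the other side, so that it lives in ℕ; the
-- series is unrolled d times.
geom-split : ∀ a d t → 0 < a → geom a t ≡ occ (multiples a d) t + sh (d * a) (geom a) t
geom-split a zero    t a>0 = refl
geom-split a (suc d) t a>0 = begin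
  geom a t
    ≡⟨ geom-split a d t a>0 ⟩
  occ (multiples a d) t + sh (d * a) (geom a) t
    ≡⟨ cong (λ z → occ (multiples a d) t + z) (trans (sh-cong (λ t → geom-rec a t a>0) (d * a) t)
         (trans (sh-+ (d * a) (δ 0) (sh a (geom a)) t)
           (cong₂ _+_ (trans (sh-δ (d * a) 0 t) (cong (λ m → δ m t) (trans (+-identityʳ _) (*-comm d a))))
                      (trans (sh-sh (d * a) a (geom a) t) (cong (λ k → sh k (geom a) t) (+-comm (d * a) a)))))) ⟩
  occ (multiples a d) t + (δ (a * d) t + sh (suc d * a) (geom a) t)
    ≡⟨ alg (occ (multiples a d) t) (δ (a * d) t) (sh (suc d * a) (geom a) t) ⟩
  occ (multiples a (suc d)) t + sh (suc d * a) (geom a) t ∎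
  where
  open ≡-Reasoning
  alg : ∀ x y z → x + (y + z) ≡ (y + x) + z
  alg = solve-∀

conv : (ℕ → ℕ) → (ℕ → ℕ) → ℕ → ℕ
conv F G t = sumUpTo (λ i → F i * G (t ∸ i)) t

sh-≤ : ∀ {k t} g → k ≤ t → sh k g t ≡ g (t ∸ k)
sh-≤ {k} {t} g k≤t = trans (cong (sh k g) (sym (m+[n∸m]≡n k≤t))) (sh-at k g (t ∸ k))

conv-δˡ : ∀ m G t → conv (δ m) G t ≡ sh m G t
conv-δˡ m G t with m ≤? t
... | yes m≤t = trans (sumUpTo-single t m m≤t (λ i _ i≢m → cong (_* G (t ∸ i)) (δ-≢ i≢m)))
                  (trans (cong (_* G (t ∸ m)) (δ-refl m)) (trans (+-identityʳ _) (sym (sh-≤ G m≤t))))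
... | no  m≰t = trans (sumUpTo-zero t (λ i i≤t → cong (_* G (t ∸ i)) (δ-≢ (<⇒≢ (≤-<-trans i≤t (≰⇒> m≰t))))))
                  (sym (sh-> G (≰⇒> m≰t)))

conv-δʳ : ∀ F m t → conv F (δ m) t ≡ sh m F t
conv-δʳ F m t with m ≤? t
... | yes m≤t = trans (sumUpTo-single t (t ∸ m) (m∸n≤m t m)
                        (λ i i≤t i≢ → trans (cong (F i *_) (δ-≢ {m} {t ∸ i} (λ eq → i≢
                          (trans (sym (m∸[m∸n]≡n i≤t)) (cong (t ∸_) eq))))) (*-zeroʳ (F i))))
                  (trans (cong (F (t ∸ m) *_) (trans (cong (δ m) (m∸[m∸n]≡n m≤t)) (δ-refl m)))
                    (trans (*-identityʳ _) (sym (sh-≤ F m≤t))))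
... | no  m≰t = trans (sumUpTo-zero t (λ i _ → trans
                  (cong (F i *_) (δ-≢ (<⇒≢ (≤-<-trans (m∸n≤m t i) (≰⇒> m≰t))))) (*-zeroʳ (F i))))
                  (sym (sh-> F (≰⇒> m≰t)))

conv-occ : ∀ F l t → conv F (occ l) t ≡ ΣL (λ w → sh w F t) l
conv-occ F []      t = sumUpTo-zero t (λ i _ → *-zeroʳ (F i))
conv-occ F (x ∷ l) t = trans
  (sumUpTo-cong t (λ i _ → *-distribˡ-+ (F i) (δ x (t ∸ i)) (occ l (t ∸ i))))
  (trans (sumUpTo-+ (λ i → F i * δ x (t ∸ i)) (λ i → F i * occ l (t ∸ i)) t)
         (cong₂ _+_ (conv-δʳ F x t) (conv-occ F l t)))

if-+ : ∀ b → (if b then + 1 else + 0) ≡ + (if b then 1 else 0)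
if-+ true  = refl
if-+ false = refl

sumUpToℤ-pos : ∀ {h h′} t → (∀ i → h i ≡ + h′ i) → sumUpToℤ h t ≡ + sumUpTo h′ t
sumUpToℤ-pos zero    eq = eq 0
sumUpToℤ-pos (suc t) eq = cong₂ ℤ._+_ (sumUpToℤ-pos t eq) (eq (suc t))

⊛-conv : ∀ {F G : Series} {F′ G′} → (∀ t → F t ≡ + F′ t) → (∀ t → G t ≡ + G′ t) →
         ∀ t → (F ⊛ G) t ≡ + conv F′ G′ t
⊛-conv {F′ = F′} {G′} eqF eqG t = sumUpToℤ-pos t
  (λ i → trans (cong₂ ℤ._*_ (eqF i) (eqG (t ∸ i))) (sym (ℤ.pos-* (F′ i) (G′ (t ∸ i)))))

sumUpToℤ-cong : ∀ {g h} t → (∀ i → g i ≡ h i) → sumUpToℤ g t ≡ sumUpToℤ h t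
sumUpToℤ-cong zero    eq = eq 0
sumUpToℤ-cong (suc t) eq = cong₂ ℤ._+_ (sumUpToℤ-cong t eq) (eq (suc t))

sumUpToℤ-minus : ∀ g h t → sumUpToℤ (λ i → g i ℤ.- h i) t ≡ sumUpToℤ g t ℤ.- sumUpToℤ h t
sumUpToℤ-minus g h zero    = refl
sumUpToℤ-minus g h (suc t) = trans (cong (ℤ._+ (g (suc t) ℤ.- h (suc t))) (sumUpToℤ-minus g h t))
  (alg (sumUpToℤ g t) (sumUpToℤ h t) (g (suc t)) (h (suc t)))
  where
  alg : ∀ x y z w → (x ℤ.- y) ℤ.+ (z ℤ.- w) ≡ (x ℤ.+ z) ℤ.- (y ℤ.+ w)
  alg = ℤSolver.solve-∀

⊖-⊛ : ∀ F G H t → ((F ⊖ G) ⊛ H) t ≡ (F ⊛ H) t ℤ.- (G ⊛ H) t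
⊖-⊛ F G H t = trans (sumUpToℤ-cong t (λ i → alg (F i) (G i) (H (t ∸ i)))) (sumUpToℤ-minus _ _ t)
  where
  alg : ∀ x y z → (x ℤ.- y) ℤ.* z ≡ x ℤ.* z ℤ.- y ℤ.* z
  alg = ℤSolver.solve-∀

xpow-δ : ∀ m t → xpow m t ≡ + δ m t
xpow-δ m t = if-+ (t ≡ᵇ m)

inv-geom : ∀ m t → invOneMinusXpow m t ≡ + geom m t
inv-geom m t = if-+ ⌊ m ∣? t ⌋

xpow-⊛-inv : ∀ m p t → (xpow m ⊛ invOneMinusXpow p) t ≡ + sh m (geom p) t
xpow-⊛-inv m p t = trans (⊛-conv (xpow-δ m) (inv-geom p) t) (cong +_ (conv-δˡ m (geom p) t))

-- The negative term -x^(da) is absorbed here, factor by factor, so that the whole product can be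
-- multiplied out over ℕ.
factor-occ : ∀ a d → 0 < a → ∀ t →
             ((oneS ⊖ xpow (d * a)) ⊛ invOneMinusXpow a) t ≡ + occ (multiples a d) t
factor-occ a d a>0 t = begin
  ((oneS ⊖ xpow (d * a)) ⊛ invOneMinusXpow a) t
    ≡⟨ ⊖-⊛ oneS (xpow (d * a)) (invOneMinusXpow a) t ⟩
  (oneS ⊛ invOneMinusXpow a) t ℤ.- (xpow (d * a) ⊛ invOneMinusXpow a) t
    ≡⟨ cong₂ ℤ._-_ (xpow-⊛-inv 0 a t) (xpow-⊛-inv (d * a) a t) ⟩
  + geom a t ℤ.- + sh (d * a) (geom a) t
    ≡⟨ cong (λ z → + z ℤ.- + sh (d * a) (geom a) t) (geom-split a d t a>0) ⟩
  (+ occ (multiples a d) t ℤ.+ + sh (d * a) (geom a) t) ℤ.- + sh (d * a) (geom a) t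
    ≡⟨ alg (+ occ (multiples a d) t) (+ sh (d * a) (geom a) t) ⟩
  + occ (multiples a d) t ∎
  where
  open ≡-Reasoning
  alg : ∀ x y → (x ℤ.+ y) ℤ.- y ≡ x
  alg = ℤSolver.solve-∀

ΠFinS-occ : ∀ {n} (A D : Fin n → ℕ) → (∀ i → 0 < A i) → ∀ t →
  ΠFinS (λ i → (oneS ⊖ xpow (D i * A i)) ⊛ invOneMinusXpow (A i)) t ≡ + occ (digitSums A D) t
ΠFinS-occ {zero}  A D A>0 t = trans (xpow-δ 0 t) (cong +_ (sym (+-identityʳ (δ 0 t))))
ΠFinS-occ {suc n} A D A>0 t = begin
  _ ≡⟨ ⊛-conv (factor-occ (A zero) (D zero) (A>0 zero)) (ΠFinS-occ (A ∘ suc) (D ∘ suc) (A>0 ∘ suc)) t ⟩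
  + conv (occ ms) (occ W′) t
    ≡⟨ cong +_ (conv-occ (occ ms) W′ t) ⟩
  + ΣL (λ w → sh w (occ ms) t) W′
    ≡⟨ cong +_ (ΣL-cong W′ (λ w → sh-occ w ms t)) ⟩
  + ΣL (λ w → ΣL (λ m → δ (w + m) t) ms) W′
    ≡⟨ cong +_ (ΣL-digitSums (λ w → δ w t) A D) ⟨
  + occ (digitSums A D) t ∎
  where
  open ≡-Reasoning
  ms = multiples (A zero) (D zero)
  W′ = digitSums (A ∘ suc) (D ∘ suc)

-- Characteristic functions, counts and sums

ι : Bool → ℕ
ι b = if b then 1 else 0

ι≡0 : ∀ {b} → ι b ≡ 0 → b ≡ false
ι≡0 {false} _ = refl

T⇒true : ∀ {b} → T b → b ≡ true
T⇒true {true} _ = refl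

¬T⇒false : ∀ {b} → ¬ T b → b ≡ false
¬T⇒false {true}  ¬t = ⊥-elim (¬t _)
¬T⇒false {false} _  = refl

≡ᵇ-true : ∀ {m n} → m ≡ n → (m ≡ᵇ n) ≡ true
≡ᵇ-true {m} {n} eq = T⇒true (≡⇒≡ᵇ m n eq)

≡ᵇ-false : ∀ {m n} → m ≢ n → (m ≡ᵇ n) ≡ false
≡ᵇ-false {m} {n} m≢n = ¬T⇒false (m≢n ∘ ≡ᵇ⇒≡ m n)

≤ᵇ-true : ∀ {m n} → m ≤ n → (m ≤ᵇ n) ≡ true
≤ᵇ-true m≤n = T⇒true (≤⇒≤ᵇ m≤n)

≤ᵇ-false : ∀ {m n} → n < m → (m ≤ᵇ n) ≡ false
≤ᵇ-false {m} {n} n<m = ¬T⇒false (<⇒≱ n<m ∘ ≤ᵇ⇒≤ m n)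

Σ< : (ℕ → ℕ) → ℕ → ℕ
Σ< h zero    = 0
Σ< h (suc B) = Σ< h B + h B

Σ<-cong : ∀ {g h} B → (∀ t → g t ≡ h t) → Σ< g B ≡ Σ< h B
Σ<-cong zero    eq = refl
Σ<-cong (suc B) eq = cong₂ _+_ (Σ<-cong B eq) (eq B)

Σ<-+ : ∀ g h B → Σ< (λ t → g t + h t) B ≡ Σ< g B + Σ< h B
Σ<-+ g h zero    = refl
Σ<-+ g h (suc B) = trans (cong (_+ (g B + h B)) (Σ<-+ g h B)) (interchange (Σ< g B) (Σ< h B) (g B) (h B))

Σ<-extend : ∀ {h} B k → (∀ t → B ≤ t → h t ≡ 0) → Σ< h (k + B) ≡ Σ< h B
Σ<-extend B zero    z = refl
Σ<-extend B (suc k) z = trans (cong₂ _+_ (Σ<-extend B k z) (z (k + B) (m≤n+m B k))) (+-identityʳ _)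

Σ<-zero : ∀ {h} B → (∀ t → t < B → h t ≡ 0) → Σ< h B ≡ 0
Σ<-zero zero    z = refl
Σ<-zero (suc B) z = cong₂ _+_ (Σ<-zero B (λ t t<B → z t (m<n⇒m<1+n t<B))) (z B ≤-refl)

Σ<-δ : ∀ (κ : ℕ → ℕ) {x B} → x < B → Σ< (λ t → δ x t * κ t) B ≡ κ x
Σ<-δ κ {x} {suc B} x<B with x ≟ B
... | yes refl = trans
  (cong₂ _+_ (Σ<-zero x (λ t t<x → cong (_* κ t) (δ-≢ (<⇒≢ t<x)))) (cong (_* κ x) (δ-refl x)))
  (+-identityʳ (κ x))
... | no  x≢B  = trans
  (cong₂ _+_ (Σ<-δ κ (≤∧≢⇒< (≤-pred x<B) x≢B)) (cong (_* κ B) (δ-≢ (x≢B ∘ sym))))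
  (+-identityʳ (κ x))

Σ<-occ : ∀ (κ : ℕ → ℕ) {B} l → All (_< B) l → Σ< (λ t → occ l t * κ t) B ≡ ΣL κ l
Σ<-occ κ {B} []      []          = Σ<-zero B (λ _ _ → refl)
Σ<-occ κ {B} (x ∷ l) (x<B ∷ l<B) = trans
  (Σ<-cong B (λ t → *-distribʳ-+ (κ t) (δ x t) (occ l t)))
  (trans (Σ<-+ (λ t → δ x t * κ t) (λ t → occ l t * κ t) B)
         (cong₂ _+_ (Σ<-δ κ x<B) (Σ<-occ κ l l<B)))

-- The weight `κ` treats both cases at once: the constant 1 for counts, the identity for sums.
HasTotal : (ℕ → ℕ) → (ℕ → Bool) → ℕ → Set
HasTotal κ P m = Σ ℕ λ B → (∀ t → B ≤ t → P t ≡ false) × (Σ< (λ t → ι (P t) * κ t) B ≡ m)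

hasCount : ∀ {P m} → HasTotal (λ _ → 1) P m → HasCount P m
hasCount {P} (B , fin , eq) = B , fin , trans (convert B) eq
  where
  convert : ∀ B → countBelow P B ≡ Σ< (λ t → ι (P t) * 1) B
  convert zero    = refl
  convert (suc B) = cong₂ _+_ (convert B) (sym (*-identityʳ (ι (P B))))

hasSum : ∀ {P m} → HasTotal (λ t → t) P m → HasSum P m
hasSum {P} (B , fin , eq) = B , fin , trans (convert B) eq
  where
  if-* : ∀ b t → (if b then t else 0) ≡ ι b * t
  if-* true  t = sym (+-identityʳ t)
  if-* false t = refl
  convert : ∀ B → sumBelow P B ≡ Σ< (λ t → ι (P t) * t) B
  convert zero    = refl
  convert (suc B) = cong₂ _+_ (convert B) (if-* (P B) B)

total-occ : ∀ κ {P B l} → (∀ t → ι (P t) ≡ occ l t) → All (_< B) l → HasTotal κ P (ΣL κ l)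
total-occ κ {P} {B} {l} eq l<B = B ,
  (λ t B≤t → ι≡0 (trans (eq t) (ΣL-zero l (λ x∈l →
    δ-≢ (λ t≡x → <⇒≱ (All.lookup l<B x∈l) (≤-trans B≤t (≤-reflexive t≡x))))))) ,
  trans (Σ<-cong B (λ t → cong (_* κ t) (eq t))) (Σ<-occ κ l l<B)

total-+ : ∀ {κ P Q R m m′} → HasTotal κ P m → HasTotal κ Q m′ →
          (∀ t → ι (R t) ≡ ι (P t) + ι (Q t)) → HasTotal κ R (m + m′)
total-+ {κ} {P} {Q} {R} (B , finP , refl) (B′ , finQ , refl) eq = B′ + B , finR , (begin
  Σ< (λ t → ι (R t) * κ t) (B′ + B)
    ≡⟨ Σ<-cong (B′ + B) (λ t → trans (cong (_* κ t) (eq t)) (*-distribʳ-+ (κ t) (ι (P t)) (ι (Q t)))) ⟩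
  Σ< (λ t → ι (P t) * κ t + ι (Q t) * κ t) (B′ + B)
    ≡⟨ Σ<-+ (λ t → ι (P t) * κ t) (λ t → ι (Q t) * κ t) (B′ + B) ⟩
  Σ< (λ t → ι (P t) * κ t) (B′ + B) + Σ< (λ t → ι (Q t) * κ t) (B′ + B)
    ≡⟨ cong₂ _+_ (Σ<-extend B B′ (vanish P finP))
         (trans (cong (Σ< (λ t → ι (Q t) * κ t)) (+-comm B′ B)) (Σ<-extend B′ B (vanish Q finQ))) ⟩
  Σ< (λ t → ι (P t) * κ t) B + Σ< (λ t → ι (Q t) * κ t) B′ ∎)
  where
  open ≡-Reasoning
  vanish : ∀ (P : ℕ → Bool) {B} → (∀ t → B ≤ t → P t ≡ false) → ∀ t → B ≤ t → ι (P t) * κ t ≡ 0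
  vanish P fin t B≤t = cong (λ b → ι b * κ t) (fin t B≤t)
  finR : ∀ t → B′ + B ≤ t → R t ≡ false
  finR t BB≤t = ι≡0 (trans (eq t) (cong₂ (λ b c → ι b + ι c)
    (finP t (≤-trans (m≤n+m B B′) BB≤t)) (finQ t (≤-trans (m≤m+n B′ B) BB≤t))))

-- The formulas, from blocks and strict increase

module Assembly
  (F : ℕ → ℕ) (p : ℕ) (p>0 : 0 < p) (W : List ℕ) (M : ℕ)
  (W-unique : Unique W) (0∈W : 0 ∈ W) (M∈W : M ∈ W) (≤M : ∀ {w} → w ∈ W → w ≤ M)
  (separated : ∀ u u′ {w w′} → w ∈ W → w′ ∈ W → u * p + w ≡ u′ * p + w′ → w ≡ w′)
  (invariant : ∀ u {w} → w ∈ W → F (u * p + w) ≡ F (u * p))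
  (covered : ∀ t → M ≤ t → Σ ℕ λ u → Σ ℕ λ w → w ∈ W × t ≡ u * p + w)
  (S₀ : ℕ) (increasing : ∀ s → S₀ ≤ s → F (s * p) < F (suc s * p))
  where

  private instance
    p≢0 : NonZero p
    p≢0 = >-nonZero p>0

  φ : ℕ → ℕ
  φ s = F (s * p)

  separated-quot : ∀ u u′ {w w′} → w ∈ W → w′ ∈ W → u * p + w ≡ u′ * p + w′ → u ≡ u′
  separated-quot u u′ {w} w∈ w′∈ eq = *-cancelʳ-≡ u u′ p (+-cancelʳ-≡ w (u * p) (u′ * p)
    (trans eq (cong (λ z → u′ * p + z) (sym (separated u u′ w∈ w′∈ eq)))))

  φ-mono : ∀ {u s} → S₀ ≤ u → u < s → φ u < φ s
  φ-mono {u} {suc s} S₀≤u u<s with u ≟ s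
  ... | yes refl = increasing u S₀≤u
  ... | no  u≢s  = <-trans (φ-mono S₀≤u u<s′) (increasing s (≤-trans S₀≤u (<⇒≤ u<s′)))
    where u<s′ = ≤∧≢⇒< (≤-pred u<s) u≢s

  φ-unbounded : ∀ k → k ≤ φ (k + S₀)
  φ-unbounded zero    = z≤n
  φ-unbounded (suc k) = ≤-<-trans (φ-unbounded k) (increasing (k + S₀) (m≤n+m S₀ k))

  -- From `threshold` on, every t lies in a block u > S₀, where `φ` increases. All earlier values
  -- are at most `bound`, their sum. In `S` the part suc bound + S₀ makes φ s exceed `bound`, and
  -- the last summand puts s p beyond `threshold`.
  threshold bound S : ℕ
  threshold = suc S₀ * p + M
  bound = sumUpTo F threshold
  S = suc bound + S₀ + threshold

  module _ {s} (S≤s : S ≤ s) where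

    S₀≤s : S₀ ≤ s
    S₀≤s = ≤-trans (≤-trans (m≤n+m S₀ (suc bound)) (m≤m+n (suc bound + S₀) threshold)) S≤s

    threshold≤ : threshold ≤ s * p
    threshold≤ = ≤-trans (≤-trans (m≤n+m threshold (suc bound + S₀)) S≤s) (m≤m*n s p)

    bound<φ : bound < φ s
    bound<φ with ≤⇒≤′ (≤-trans (m≤m+n (suc bound + S₀) threshold) S≤s)
    ... | ≤′-refl   = φ-unbounded (suc bound)
    ... | ≤′-step l = <-trans (φ-unbounded (suc bound))
                        (φ-mono (m≤n+m S₀ (suc bound)) (s≤s (≤′⇒≤ l)))

  -- A t before the threshold may lie in no block, so `below` records only that no block u ≥ s
  -- contains it. Its bound t ≤ s p + M is what the maxima need.
  data Position (s t : ℕ) : Set where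
    below : F t < φ s → (∀ {u w} → s ≤ u → w ∈ W → t ≢ u * p + w) → t ≤ s * p + M → Position s t
    at    : ∀ {w} → w ∈ W → t ≡ s * p + w → F t ≡ φ s → Position s t
    above : ∀ {u w} → s < u → w ∈ W → t ≡ u * p + w → φ s < F t → Position s t

  classify : ∀ {s} → S ≤ s → ∀ t → Position s t
  classify {s} S≤s t with t <? threshold
  ... | yes t<T = below (≤-<-trans (≤-sumUpTo F (<⇒≤ t<T)) (bound<φ S≤s))
    (λ {u} {w} s≤u w∈ eq → <⇒≱ t<T (≤-trans (threshold≤ S≤s)
      (≤-trans (*-monoˡ-≤ p s≤u) (≤-trans (m≤m+n (u * p) w) (≤-reflexive (sym eq))))))
    (≤-trans (<⇒≤ t<T) (≤-trans (threshold≤ S≤s) (m≤m+n (s * p) M)))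
  ... | no  t≮T with covered t (≤-trans (m≤n+m M (suc S₀ * p)) (≮⇒≥ t≮T))
  ... | u , w , w∈ , refl with <-cmp u s
  ... | tri< u<s _ _ = below (subst (_< φ s) (sym (invariant u w∈)) (φ-mono S₀≤u u<s))
    (λ {u′} s≤u′ w′∈ eq → <⇒≢ (<-≤-trans u<s s≤u′) (separated-quot u u′ w∈ w′∈ eq))
    (+-mono-≤ (*-monoˡ-≤ p (<⇒≤ u<s)) (≤M w∈))
    where
    S₀≤u : S₀ ≤ u
    S₀≤u = <⇒≤ (*-cancelʳ-≤ (suc S₀) u p (+-cancelʳ-≤ M (suc S₀ * p) (u * p)
      (≤-trans (≮⇒≥ t≮T) (+-monoʳ-≤ (u * p) (≤M w∈)))))
  ... | tri≈ _ refl _ = at w∈ refl (invariant u w∈)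
  ... | tri> _ _ u>s = above u>s w∈ refl
    (subst (φ s <_) (sym (invariant u w∈)) (φ-mono (S₀≤s S≤s) u>s))

  level : ℕ → List ℕ
  level s = map (λ z → s * p + z) W

  eqk lek gek : ℕ → ℕ → Bool
  eqk s t = F t ≡ᵇ φ s
  lek s t = F t ≤ᵇ φ s
  gek s t = φ s ≤ᵇ F t

  top-eq : ∀ s → F (s * p + M) ≡ φ s
  top-eq s = invariant s M∈W

  max-eqk : ∀ {s} → S ≤ s → IsMax (eqk s) (s * p + M)
  max-eqk {s} S≤s = ≡ᵇ-true (top-eq s) , beyond
    where
    beyond : ∀ t → s * p + M < t → eqk s t ≡ false
    beyond t max<t with classify S≤s t
    ... | below _ _ t≤ = ⊥-elim (<⇒≱ max<t t≤)
    ... | at w∈ refl _ = ⊥-elim (<⇒≱ max<t (+-monoʳ-≤ (s * p) (≤M w∈)))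
    ... | above _ _ _ φ<F = ≡ᵇ-false (λ eq → <⇒≢ φ<F (sym eq))

  max-lek : ∀ {s} → S ≤ s → IsMax (lek s) (s * p + M)
  max-lek {s} S≤s = ≤ᵇ-true (≤-reflexive (top-eq s)) , beyond
    where
    beyond : ∀ t → s * p + M < t → lek s t ≡ false
    beyond t max<t with classify S≤s t
    ... | below _ _ t≤ = ⊥-elim (<⇒≱ max<t t≤)
    ... | at w∈ refl _ = ⊥-elim (<⇒≱ max<t (+-monoʳ-≤ (s * p) (≤M w∈)))
    ... | above _ _ _ φ<F = ≤ᵇ-false φ<F

  before : ∀ {s} → S ≤ s → ∀ t → t < s * p → F t < φ s
  before {s} S≤s t t<sp with classify S≤s t
  ... | below F<φ _ _ = F<φ
  ... | at {w} _ refl _ = ⊥-elim (<⇒≱ t<sp (m≤m+n (s * p) w))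
  ... | above {u} {w} s<u _ refl _ = ⊥-elim (<⇒≱ t<sp (≤-trans (*-monoˡ-≤ p (<⇒≤ s<u)) (m≤m+n (u * p) w)))

  min-eqk : ∀ {s} → S ≤ s → IsMin (eqk s) (s * p)
  min-eqk {s} S≤s = ≡ᵇ-true {φ s} refl , λ t t<sp → ≡ᵇ-false (<⇒≢ (before S≤s t t<sp))

  min-gek : ∀ {s} → S ≤ s → IsMin (gek s) (s * p)
  min-gek {s} S≤s = ≤ᵇ-true {φ s} ≤-refl , λ t t<sp → ≤ᵇ-false (before S≤s t t<sp)

  ι-eqk : ∀ {s} → S ≤ s → ∀ t → ι (eqk s t) ≡ ΣL (λ w → δ (s * p + w) t) W
  ι-eqk {s} S≤s t with classify S≤s t
  ... | below F<φ absent _ = trans (cong ι (≡ᵇ-false (<⇒≢ F<φ)))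
    (sym (ΣL-zero W (λ w∈ → δ-≢ (absent ≤-refl w∈))))
  ... | at {w} w∈ refl F≡φ = trans (cong ι (≡ᵇ-true F≡φ))
    (sym (trans (ΣL-single W-unique w∈ (λ {x} _ x≢w → δ-≢ (λ eq → x≢w (sym (+-cancelˡ-≡ (s * p) w x eq)))))
      (δ-refl (s * p + w))))
  ... | above {u} s<u w∈ refl φ<F = trans (cong ι (≡ᵇ-false (λ eq → <⇒≢ φ<F (sym eq))))
    (sym (ΣL-zero W (λ x∈ → δ-≢ (λ eq → <⇒≢ s<u (sym (separated-quot u s w∈ x∈ eq))))))

  hit : ∀ {s u} w → s ≤ u → sh w (sh (s * p) (geom p)) (u * p + w) ≡ 1
  hit {s} {u} w s≤u = begin
    sh w (sh (s * p) (geom p)) (u * p + w)   ≡⟨ cong (sh w (sh (s * p) (geom p))) (+-comm (u * p) w) ⟩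
    sh w (sh (s * p) (geom p)) (w + u * p)   ≡⟨ sh-at w _ (u * p) ⟩
    sh (s * p) (geom p) (u * p)              ≡⟨ sh-≤ (geom p) (*-monoˡ-≤ p s≤u) ⟩
    geom p (u * p ∸ s * p)                   ≡⟨ cong (geom p) (*-distribʳ-∸ p u s) ⟨
    geom p ((u ∸ s) * p)                     ≡⟨ geom-∣ (n∣m*n (u ∸ s)) ⟩
    1 ∎
    where open ≡-Reasoning

  miss : ∀ {s t} w → (∀ {u} → s ≤ u → t ≢ u * p + w) → sh w (sh (s * p) (geom p)) t ≡ 0
  miss {s} {t} w absent with w + s * p ≤? t
  ... | no  ≰t = trans (sh-sh w (s * p) (geom p) t) (sh-> (geom p) (≰⇒> ≰t))
  ... | yes ≤t = trans (sh-sh w (s * p) (geom p) t) (trans (sh-≤ (geom p) ≤t)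
    (geom-∤ (λ { (divides k eq) → absent {k + s} (m≤n+m s k)
      (trans (sym (m∸n+n≡m ≤t)) (trans (cong (_+ (w + s * p)) eq) (alg k p w s))) })))
    where
    alg : ∀ k p w s → k * p + (w + s * p) ≡ (k + s) * p + w
    alg = solve-∀

  -- The series x^(sp+w) / (1 - x^p) marks the numbers u p + w with u ≥ s. Since block and offset
  -- are determined by t, at most one w contributes.
  ι-gek : ∀ {s} → S ≤ s → ∀ t → ι (gek s t) ≡ ΣL (λ w → sh w (sh (s * p) (geom p)) t) W
  ι-gek {s} S≤s t with classify S≤s t
  ... | below F<φ absent _ = trans (cong ι (≤ᵇ-false F<φ))
    (sym (ΣL-zero W (λ {w} w∈ → miss w (λ s≤u → absent s≤u w∈))))
  ... | at {w} w∈ refl F≡φ = trans (cong ι (≤ᵇ-true (≤-reflexive (sym F≡φ))))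
    (sym (trans (ΣL-single W-unique w∈ (λ {x} x∈ x≢w → miss {s} x
      (λ {u} _ eq → x≢w (sym (separated s u w∈ x∈ eq))))) (hit {s} w ≤-refl)))
  ... | above {u} {w} s<u w∈ refl φ<F = trans (cong ι (≤ᵇ-true (<⇒≤ φ<F)))
    (sym (trans (ΣL-single W-unique w∈ (λ {x} x∈ x≢w → miss {s} x
      (λ {u′} _ eq → x≢w (sym (separated u u′ w∈ x∈ eq))))) (hit {s} w (<⇒≤ s<u))))

  total-eqk : ∀ κ {s} → S ≤ s → HasTotal κ (eqk s) (ΣL κ (level s))
  total-eqk κ {s} S≤s = total-occ κ
    (λ t → trans (ι-eqk S≤s t) (sym (ΣL-map (λ w → δ w t) (λ z → s * p + z) W)))
    (All.map⁺ (All.tabulate (λ w∈ → s≤s (+-monoʳ-≤ (s * p) (≤M w∈)))))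

  -- `F` takes no value strictly between φ s and φ (s + 1): a t below level s + 1 lies in no block
  -- beyond s, so at level s it is below or in the block.
  ι-lek-suc : ∀ {s} → S ≤ s → ∀ t → ι (lek (suc s) t) ≡ ι (lek s t) + ι (eqk (suc s) t)
  ι-lek-suc {s} S≤s t with classify (m≤n⇒m≤1+n S≤s) t
  ... | below F<φ absent _ = trans (cong ι (≤ᵇ-true (<⇒≤ F<φ)))
    (sym (cong₂ (λ b c → ι b + ι c) (≤ᵇ-true F≤φ) (≡ᵇ-false (<⇒≢ F<φ))))
    where
    F≤φ : F t ≤ φ s
    F≤φ with classify S≤s t
    ... | below F<φ _ _      = <⇒≤ F<φ
    ... | at _ _ F≡φ         = ≤-reflexive F≡φ
    -- s < u unfolds to suc s ≤ u, so `absent`, obtained at level s + 1, applies to this block.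
    ... | above s<u w∈ eq _  = ⊥-elim (absent s<u w∈ eq)
  ... | at _ _ F≡φ = trans (cong ι (≤ᵇ-true (≤-reflexive F≡φ)))
    (sym (cong₂ (λ b c → ι b + ι c)
      (≤ᵇ-false (subst (φ s <_) (sym F≡φ) (increasing s (S₀≤s S≤s)))) (≡ᵇ-true F≡φ)))
  ... | above _ _ _ φ<F = trans (cong ι (≤ᵇ-false φ<F))
    (sym (cong₂ (λ b c → ι b + ι c)
      (≤ᵇ-false (<-trans (increasing s (S₀≤s S≤s)) φ<F)) (≡ᵇ-false (λ eq → <⇒≢ φ<F (sym eq)))))

  -- The total at `S` is left as a finite sum, and each later level adds one block. The constants C₁
  -- and C₂ absorb this start.
  lekTotal : (ℕ → ℕ) → ℕ → ℕ
  lekTotal κ zero    = Σ< (λ t → ι (lek S t) * κ t) (suc (S * p + M))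
  lekTotal κ (suc j) = lekTotal κ j + ΣL κ (level (suc j + S))

  total-lek : ∀ κ j → HasTotal κ (lek (j + S)) (lekTotal κ j)
  total-lek κ zero    = suc (S * p + M) , (λ t → proj₂ (max-lek ≤-refl) t) , refl
  total-lek κ (suc j) = total-+ (total-lek κ j) (total-eqk κ (m≤n+m S (suc j))) (ι-lek-suc (m≤n+m S j))

  level-count : ∀ s → ΣL (λ _ → 1) (level s) ≡ ΣL (λ _ → 1) W
  level-count s = ΣL-map (λ _ → 1) (λ z → s * p + z) W

  level-sum : ∀ s → ΣL (λ w → w) (level s) ≡ ΣL (λ w → w) W + ΣL (λ _ → 1) W * (s * p)
  level-sum s = trans (ΣL-map (λ w → w) (λ z → s * p + z) W)
    (trans (ΣL-cong W (λ w → trans (+-comm (s * p) w) (cong (_+ s * p) (sym (*-identityʳ w)))))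
      (trans (ΣL-affine (s * p) 1 W) (cong (_+ ΣL (λ _ → 1) W * (s * p)) (*-identityʳ (ΣL (λ w → w) W)))))

-- Arithmetic of the numbers dᵢ, and f on blocks

gcdList∣lookup : ∀ {n} (a : Vec ℕ n) i → gcdList (toList a) ∣ lookup a i
gcdList∣lookup (x ∷ a) zero    = gcd[m,n]∣m x _
gcdList∣lookup (x ∷ a) (suc i) = ∣-trans (gcd[m,n]∣n x _) (gcdList∣lookup a i)

dd∣lookup : ∀ {n} (a : Vec ℕ n) {i j} → i ≢ j → dd a i ∣ lookup a j
dd∣lookup (x ∷ a) {zero}  {zero}  i≢j = ⊥-elim (i≢j refl)
dd∣lookup (x ∷ a) {zero}  {suc j} i≢j = gcdList∣lookup a j
dd∣lookup (x ∷ a) {suc i} {zero}  i≢j = gcd[m,n]∣m x _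
dd∣lookup (x ∷ a) {suc i} {suc j} i≢j = ∣-trans (gcd[m,n]∣n x _) (dd∣lookup a (i≢j ∘ cong suc))

∣gcdList : ∀ {n} (a : Vec ℕ n) i {k} → k ∣ dd a i → k ∣ lookup a i → k ∣ gcdList (toList a)
∣gcdList (x ∷ a) zero    k∣d k∣x = gcd-greatest k∣x k∣d
∣gcdList (x ∷ a) (suc i) k∣d k∣y =
  gcd-greatest (∣-trans k∣d (gcd[m,n]∣m x _)) (∣gcdList a i (∣-trans k∣d (gcd[m,n]∣n x _)) k∣y)

removeEntry-Rem : ∀ {n} (a : Vec ℕ n) i → Rem (lookup a i) (toList a) (removeEntry a i)
removeEntry-Rem (x ∷ a) zero    = here
removeEntry-Rem (x ∷ a) (suc i) = there (removeEntry-Rem a i)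

Rem-removeEntry : ∀ {n} (a : Vec ℕ n) {x cs} → Rem x (toList a) cs → Σ (Fin n) λ i → cs ≡ removeEntry a i
Rem-removeEntry (x ∷ a) here      = zero , refl
Rem-removeEntry (x ∷ a) (there r) with Rem-removeEntry a r
... | i , refl = suc i , refl

toList-positive : ∀ {n} (a : Vec ℕ n) → (∀ i → 0 < lookup a i) → Positive (toList a)
toList-positive []      a>0 = []
toList-positive (x ∷ a) a>0 = a>0 zero ∷ toList-positive a (a>0 ∘ suc)

-- A positive entry always remains after the removal. For a vector with a single entry the gcd would
-- be that of the empty list, which is 0.
dd>0 : ∀ {n} (a : Vec ℕ (suc (suc n))) → (∀ i → 0 < lookup a i) → ∀ i → 0 < dd a i
dd>0 (x ∷ y ∷ a) a>0 zero    = n≢0⇒n>0 (λ eq → >⇒≢ (a>0 (suc zero)) (gcd[m,n]≡0⇒m≡0 eq))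
dd>0 (x ∷ y ∷ a) a>0 (suc i) = n≢0⇒n>0 (λ eq → >⇒≢ (a>0 zero) (gcd[m,n]≡0⇒m≡0 eq))

dd-system : ∀ {n} (a : Vec ℕ (suc (suc n))) → (∀ i → 0 < lookup a i) → gcdList (toList a) ≡ 1 →
            System (lookup a) (dd a)
dd-system a a>0 gcd≡1 = record
  { A>0     = a>0
  ; D>0     = dd>0 a a>0
  ; coprime = λ i (k∣d , k∣a) → ∣1⇒≡1 (subst (_ ∣_) gcd≡1 (∣gcdList a i k∣d k∣a))
  ; D∣A     = dd∣lookup a
  }

countSol-∤ : ∀ cs {t} → ¬ gcdList cs ∣ t → countSol cs t ≡ 0
countSol-∤ []       {zero}  ∤t = ⊥-elim (∤t ∣-refl)
countSol-∤ []       {suc t} ∤t = refl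
countSol-∤ (c ∷ cs) {t}     ∤t = trans (countSol≡partialSol c cs t) (sumUpTo-zero t (λ i _ → term i))
  where
  term : ∀ i → sh (c * i) (countSol cs) t ≡ 0
  term i with c * i ≤? t
  ... | no  ≰t = sh-> (countSol cs) (≰⇒> ≰t)
  ... | yes ≤t = trans (sh-≤ (countSol cs) ≤t) (countSol-∤ cs (λ g∣ → ∤t
    (subst (gcd c (gcdList cs) ∣_) (m+[n∸m]≡n ≤t) (∣m∣n⇒∣m+n
      (∣m⇒∣m*n i (gcd[m,n]∣m c _)) (∣-trans (gcd[m,n]∣n c _) g∣)))))

f-step : ∀ {n} (a : Vec ℕ n) → (∀ i → 0 < lookup a i) → ∀ i t →
         ¬ dd a i ∣ lookup a i + t → f a (lookup a i + t) ≡ f a t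
f-step a a>0 i t ∤ = trans (countSol-step (toList-positive a a>0) (removeEntry-Rem a i) t)
  (trans (cong (λ z → f a t + z) (countSol-∤ (removeEntry a i) ∤)) (+-identityʳ (f a t)))

f-increasing : ∀ {n} (a : Vec ℕ (suc (suc n))) → (∀ i → 0 < lookup a i) → gcdList (toList a) ≡ 1 →
  Σ ℕ λ S → ∀ s → S ≤ s → f a (s * pp a) < f a (suc s * pp a)
f-increasing a@(x ∷ y ∷ as) a>0 gcd≡1 =
  countSol-increasing (ΠFin>0 (dd>0 a a>0)) x y (toList as) (toList-positive a a>0) gcd≡1 gcd∣p
  where
  gcd∣p : ∀ {x cs} → Rem x (toList a) cs → gcdList cs ∣ pp a
  gcd∣p r with Rem-removeEntry a r
  ... | i , refl = ∣ΠFin (dd a) i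

-- The constants and the conclusion

pos-balance : ∀ {x c y d} → x + c ≡ y + d → + x ≡ + y ℤ.+ (+ d ℤ.- + c)
pos-balance {x} {c} {y} {d} eq = trans (alg (+ x) (+ c))
  (trans (cong (ℤ._- + c) (cong +_ eq)) (ℤ.+-assoc (+ y) (+ d) (ℤ.- + c)))
  where
  alg : ∀ x c → x ≡ (x ℤ.+ c) ℤ.- c
  alg = ℤSolver.solve-∀

indicator-ι : ∀ P t → indicator P t ≡ + ι (P t)
indicator-ι P t = if-+ (P t)

theorem1p12 : (n : ℕ) (a : Vec ℕ n) → 2 ≤ n → (∀ i → 0 < lookup a i) → gcdList (toList a) ≡ 1 →
    Σ ℤ λ C₁ → Σ ℤ λ C₂ → Σ ℕ λ S → ∀ s → S ≤ s →
      let p = pp a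
          k = f a (s * p)
          eqk = λ t → f a t ≡ᵇ k
          lek = λ t → f a t ≤ᵇ k
          gek = λ t → k ≤ᵇ f a t
      in IsMax eqk (s * p + ΣFin (λ i → (dd a i ∸ 1) * lookup a i))
       × IsMax lek (s * p + ΣFin (λ i → (dd a i ∸ 1) * lookup a i))
       × IsMin eqk (s * p)
       × IsMin gek (s * p)
       × HasCount eqk p
       × (Σ ℕ λ c → HasCount lek c × (+ c ≡ + (s * p) ℤ.+ C₁))
       × (Σ ℕ λ m → HasSum eqk m × (2 * m ≡ 2 * (s * p * p) + ΣFin (λ i → p * lookup a i * (dd a i ∸ 1))))
       × (Σ ℕ λ m → HasSum lek m
            × (+ (2 * m) ≡ + ((s * p) * (s * p)) ℤ.+ + ((p + ΣFin (λ i → lookup a i * (dd a i ∸ 1))) * (s * p)) ℤ.+ C₂))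
       × (∀ t → indicator eqk t ≡ (xpow (s * p) ⊛ prodFactor a) t)
       × (∀ t → indicator gek t ≡ (xpow (s * p) ⊛ invOneMinusXpow p ⊛ prodFactor a) t)
theorem1p12 (suc zero) a (s≤s ()) a>0 gcd≡1
theorem1p12 (suc (suc n)) a 2≤n a>0 gcd≡1 = C₁ , C₂ , S , λ s S≤s →
    max-eqk S≤s , max-lek S≤s , min-eqk S≤s , min-gek S≤s
  , subst (HasCount (eqk s)) (trans (level-count s) count-W) (hasCount (total-eqk (λ _ → 1) S≤s))
  -- Cumulative totals are indexed by the number s - S of levels beyond `S`.
  , subst (λ s → Σ ℕ λ c → HasCount (lek s) c × (+ c ≡ + (s * p) ℤ.+ C₁)) (m∸n+n≡m S≤s)
      (lekTotal (λ _ → 1) (s ∸ S) , hasCount (total-lek (λ _ → 1) (s ∸ S)) , pos-balance (lekCount (s ∸ S)))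
  , (ΣL (λ w → w) (level s) , hasSum (total-eqk (λ t → t) S≤s) , level-sum₂ s)
  , subst (λ s → Σ ℕ λ m → HasSum (lek s) m × (+ (2 * m) ≡ + ((s * p) * (s * p)) ℤ.+ + ((p + E) * (s * p)) ℤ.+ C₂))
      (m∸n+n≡m S≤s)
      (lekTotal (λ t → t) (s ∸ S) , hasSum (total-lek (λ t → t) (s ∸ S)) , pos-balance (lekSum (s ∸ S)))
  , (λ t → trans (indicator-ι (eqk s) t) (trans (cong +_ (ι-eqk S≤s t)) (sym (series-eq s t))))
  , (λ t → trans (indicator-ι (gek s) t) (trans (cong +_ (ι-gek S≤s t)) (sym (series-ge s t))))
  where
  p = pp a
  sys = dd-system a a>0 gcd≡1
  W = digitSums (lookup a) (dd a)
  E = ΣFin (λ i → lookup a i * (dd a i ∸ 1))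

  separated : ∀ u u′ {w w′} → w ∈ W → w′ ∈ W → u * p + w ≡ u′ * p + w′ → w ≡ w′
  separated u u′ w∈ w′∈ eq with ∈-digitSums⁻ (lookup a) (dd a) w∈ | ∈-digitSums⁻ (lookup a) (dd a) w′∈
  ... | r , r<d , refl | r′ , r′<d , refl = val-unique sys
    (λ i → ∣n⇒∣m*n u (∣ΠFin (dd a) i)) (λ i → ∣n⇒∣m*n u′ (∣ΠFin (dd a) i)) r<d r′<d eq

  invariant : ∀ u {w} → w ∈ W → f a (u * p + w) ≡ f a (u * p)
  invariant u w∈ with ∈-digitSums⁻ (lookup a) (dd a) w∈
  ... | r , r<d , refl = trans (cong (f a) (+-comm (u * p) _))
    (val-invariant sys (f a) (f-step a a>0) r<d (λ i → ∣n⇒∣m*n u (∣ΠFin (dd a) i)))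

  inc = f-increasing a a>0 gcd≡1

  open Assembly (f a) p (ΠFin>0 (dd>0 a a>0)) W (System.maxSum sys) (digitSums-unique sys)
    (System.0∈ sys) (System.maxSum∈ sys) (System.∈⇒≤maxSum sys)
    separated invariant (cover a sys gcd≡1) (proj₁ inc) (proj₂ inc)

  count-W : ΣL (λ _ → 1) W ≡ p
  count-W = digitSums-count (lookup a) (dd a)

  level-sum₂ : ∀ s → 2 * ΣL (λ w → w) (level s) ≡ 2 * (s * p * p) + ΣFin (λ i → p * lookup a i * (dd a i ∸ 1))
  level-sum₂ s = begin
    2 * ΣL (λ w → w) (level s)                          ≡⟨ cong (2 *_) (level-sum s) ⟩
    2 * (ΣL (λ w → w) W + ΣL (λ _ → 1) W * (s * p))     ≡⟨ cong (λ z → 2 * (ΣL (λ w → w) W + z * (s * p))) count-W ⟩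
    2 * (ΣL (λ w → w) W + p * (s * p))                  ≡⟨ alg (ΣL (λ w → w) W) p (s * p) ⟩
    2 * (s * p * p) + 2 * ΣL (λ w → w) W                ≡⟨ cong (λ z → 2 * (s * p * p) + z)
                                                             (digitSums-sum (lookup a) (dd a)) ⟩
    2 * (s * p * p) + ΣFin (λ i → p * lookup a i * (dd a i ∸ 1)) ∎
    where
    open ≡-Reasoning
    alg : ∀ x p y → 2 * (x + p * y) ≡ 2 * (y * p) + 2 * x
    alg = solve-∀

  quad : ℕ → ℕ
  quad x = x * x + (p + E) * x

  -- Total minus main terms, taken at s = S. The identity for sums is proved in doubled form, so
  -- this C₂ is twice the constant of the formula with halves.
  C₁ C₂ : ℤ
  C₁ = + lekTotal (λ _ → 1) 0 ℤ.- + (S * p)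
  C₂ = + (2 * lekTotal (λ t → t) 0) ℤ.- + quad (S * p)

  lekCount : ∀ j → lekTotal (λ _ → 1) j + S * p ≡ (j + S) * p + lekTotal (λ _ → 1) 0
  lekCount zero    = +-comm (lekTotal (λ _ → 1) 0) (S * p)
  lekCount (suc j) = begin
    lekTotal (λ _ → 1) j + ΣL (λ _ → 1) (level (suc j + S)) + S * p
      ≡⟨ cong (λ z → lekTotal (λ _ → 1) j + z + S * p) (trans (level-count (suc j + S)) count-W) ⟩
    lekTotal (λ _ → 1) j + p + S * p
      ≡⟨ alg (lekTotal (λ _ → 1) j) p (S * p) ⟩
    p + (lekTotal (λ _ → 1) j + S * p)
      ≡⟨ cong (λ z → p + z) (lekCount j) ⟩
    p + ((j + S) * p + lekTotal (λ _ → 1) 0)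
      ≡⟨ +-assoc p ((j + S) * p) _ ⟨
    (suc j + S) * p + lekTotal (λ _ → 1) 0 ∎
    where
    open ≡-Reasoning
    alg : ∀ x y z → x + y + z ≡ y + (x + z)
    alg = solve-∀

  -- The doubled sum of level s + 1 is 2 (s + 1) p² + p E, exactly the increment of `quad` from s p
  -- to (s + 1) p. This is the origin of the linear coefficient p + E.
  lekSum : ∀ j → 2 * lekTotal (λ t → t) j + quad (S * p) ≡ quad ((j + S) * p) + 2 * lekTotal (λ t → t) 0
  lekSum zero    = +-comm (2 * lekTotal (λ t → t) 0) (quad (S * p))
  lekSum (suc j) = begin
    2 * (L + ΣL (λ w → w) (level (suc j + S))) + quad (S * p)
      ≡⟨ alg L (ΣL (λ w → w) (level (suc j + S))) (quad (S * p)) ⟩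
    2 * ΣL (λ w → w) (level (suc j + S)) + (2 * L + quad (S * p))
      ≡⟨ cong₂ _+_ (trans (level-sum₂ (suc j + S)) (cong (λ z → 2 * ((p + x) * p) + z) E*p)) (lekSum j) ⟩
    2 * ((p + x) * p) + p * E + (quad x + 2 * lekTotal (λ t → t) 0)
      ≡⟨ alg′ p x E (2 * lekTotal (λ t → t) 0) ⟩
    quad (p + x) + 2 * lekTotal (λ t → t) 0 ∎
    where
    open ≡-Reasoning
    L = lekTotal (λ t → t) j
    x = (j + S) * p
    E*p : ΣFin (λ i → p * lookup a i * (dd a i ∸ 1)) ≡ p * E
    E*p = trans (ΣFin-cong (λ i → *-assoc p (lookup a i) (dd a i ∸ 1)))
                (ΣFin-* p (λ i → lookup a i * (dd a i ∸ 1)))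
    alg : ∀ l y q → 2 * (l + y) + q ≡ 2 * y + (2 * l + q)
    alg = solve-∀
    alg′ : ∀ p x e c → 2 * ((p + x) * p) + p * e + (x * x + (p + e) * x + c) ≡
                       (p + x) * (p + x) + (p + e) * (p + x) + c
    alg′ = solve-∀

  prodFactor-occ : ∀ t → prodFactor a t ≡ + occ W t
  prodFactor-occ = ΠFinS-occ (lookup a) (dd a) a>0

  series-eq : ∀ s t → (xpow (s * p) ⊛ prodFactor a) t ≡ + ΣL (λ w → δ (s * p + w) t) W
  series-eq s t = trans (⊛-conv (xpow-δ (s * p)) prodFactor-occ t)
    (cong +_ (trans (conv-occ (δ (s * p)) W t) (ΣL-cong W (λ w →
      trans (sh-δ w (s * p) t) (cong (λ m → δ m t) (+-comm w (s * p)))))))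

  series-ge : ∀ s t → (xpow (s * p) ⊛ invOneMinusXpow p ⊛ prodFactor a) t ≡
                      + ΣL (λ w → sh w (sh (s * p) (geom p)) t) W
  series-ge s t = trans (⊛-conv (xpow-⊛-inv (s * p) p) prodFactor-occ t)
    (cong +_ (conv-occ (sh (s * p) (geom p)) W t))
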